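{- Fix a positive constant $d$. On the hypercube $Q_n$, a robber can escape capture against $n^d$ cops for at least $(1-o(1))\frac{1}{2} n \ln n$ rounds. That is, there is a function $\varepsilon(n) \to 0$ such that for all sufficiently large $n$, for every strategy of $n^d$ cops on $Q_n$, the robber has a strategy that avoids capture for at least $(1-\varepsilon(n))\frac{1}{2} n\ln n$ rounds.
   Context: Cops and Robbers is played on a finite reflexive graph (every vertex carries a loop, so a player may pass). The cops first choose starting vertices, then the robber chooses a starting vertex; afterwards players alternate, the cops moving first: each cop moves to a neighbouring vertex or stays, then the robber moves to a neighbouring vertex or stays. A round is a cop move together with the subsequent robber move. The cops capture the robber when some cop occupies the same vertex as the robber. $Q_n$ is the $n$-dimensional hypercube: vertices are binary strings of length $n$, adjacent iff they differ in exactly one coordinate. -}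

module Defs where

open import Data.Bool using (Bool; true; false)
open import Data.Nat as ℕ using (ℕ; zero; suc; _≤_)
open import Data.Integer using (+_)
open import Data.Rational as ℚ using (ℚ; 0ℚ; 1ℚ)
open import Data.Vec using (Vec; []; _∷_)
open import Data.Vec.Relation.Unary.Any using (Any)
open import Data.Vec.Relation.Binary.Pointwise.Inductive using (Pointwise)
open import Data.List using (List; []; _∷_)
open import Data.Product using (_×_; _,_; Σ)
open import Data.Sum using (_⊎_)
open import Relation.Binary.PropositionalEquality using (_≡_)
open import Relation.Nullary using (¬_)
open import Data.Bool using (if_then_else_)
open import Data.Bool.Properties using () renaming (_≟_ to _≟ᵇ_)
open import Relation.Nullary.Decidable using (does)

V : ℕ → Set
V n = Vec Bool n

hamming : ∀ {n} → V n → V n → ℕ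
hamming []       []       = 0
hamming (a ∷ u) (b ∷ v) = (if does (a ≟ᵇ b) then 0 else 1) ℕ.+ hamming u v

Adj : ∀ {n} → V n → V n → Set
Adj u v = hamming u v ≡ 1

Move : ∀ {n} → V n → V n → Set
Move u v = u ≡ v ⊎ Adj u v

Config : ℕ → ℕ → Set
Config n k = Vec (V n) k

CopMove : ∀ {n k} → Config n k → Config n k → Set
CopMove c c' = Pointwise Move c c'

Caught : ∀ {n k} → Config n k → V n → Set
Caught c r = Any (r ≡_) c

-- A history is the list of positions (cops , robber) at the start of each
-- round so far, most recent first.
History : ℕ → ℕ → Set
History n k = List (Config n k × V n)

record CopStrategy (n k : ℕ) : Set where
  field
    cstart : Config n k
    cmove  : History n k → Config n k

record RobberStrategy (n k : ℕ) : Set where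
  field
    rstart : Config n k → V n
    -- sees the history and the cops' new positions
    rmove  : History n k → Config n k → V n

open CopStrategy public
open RobberStrategy public

LegalCop : ∀ {n k} → CopStrategy n k → Set
LegalCop {n} {k} σ = ∀ (c : Config n k) (r : V n) (h : History n k) →
  CopMove c (cmove σ ((c , r) ∷ h))

LegalRobber : ∀ {n k} → RobberStrategy n k → Set
LegalRobber {n} {k} ρ = ∀ (c c' : Config n k) (r : V n) (h : History n k) →
  Move r (rmove ρ ((c , r) ∷ h) c')

module Play {n k : ℕ} (σ : CopStrategy n k) (ρ : RobberStrategy n k) where
  -- history after i rounds (length i+1, head = current position)
  hist : ℕ → History n k
  hist zero    = (cstart σ , rstart ρ (cstart σ)) ∷ []
  hist (suc i) = (cmove σ (hist i) , rmove ρ (hist i) (cmove σ (hist i))) ∷ hist i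

  -- position at the start of round i+1 (i.e. after i rounds)
  pos : ℕ → Config n k × V n
  pos zero    = cstart σ , rstart ρ (cstart σ)
  pos (suc i) = cmove σ (hist i) , rmove ρ (hist i) (cmove σ (hist i))

Survives : ∀ {n k} → CopStrategy n k → RobberStrategy n k → ℕ → Set
Survives σ ρ T =
  ¬ Caught (Data.Product.proj₁ (pos 0)) (Data.Product.proj₂ (pos 0)) ×
  (∀ i → i ℕ.< T →
     ¬ Caught (cmove σ (hist i)) (Data.Product.proj₂ (pos i)) ×
     ¬ Caught (Data.Product.proj₁ (pos (suc i))) (Data.Product.proj₂ (pos (suc i))))
  where open Play σ ρ

fromℕ : ℕ → ℚ
fromℕ m = + m ℚ./ 1

expTerm : ℚ → ℕ → ℚ
expTerm y zero    = 1ℚ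
expTerm y (suc k) = expTerm y k ℚ.* y ℚ.* (+ 1 ℚ./ suc k)

expPartial : ℚ → ℕ → ℚ
expPartial y zero    = 0ℚ
expPartial y (suc m) = expPartial y m ℚ.+ expTerm y m

-- 0 ≤ y ≤ ln n, i.e. y ≥ 0 and e^y ≤ n (all partial sums of the series ≤ n)
_≤ln_ : ℚ → ℕ → Set
y ≤ln n = 0ℚ ℚ.≤ y × (∀ m → expPartial y m ℚ.≤ fromℕ n)

TendsToZero : (ℕ → ℚ) → Set
TendsToZero ε = ∀ (δ : ℚ) → 0ℚ ℚ.< δ →
  Σ ℕ λ N → ∀ n → N ≤ n → ℚ.∣ ε n ∣ ℚ.≤ δ

{-# OPTIONS --safe #-}
-- The potential of a cop at distance d from the robber, with j rounds to go, is (1 - μⱼ)ᵈ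
-- where μⱼ = η (1 - α)ʲ and α = 2 (1 + η) / n. Averaged over the n neighbours the robber may
-- move to, it does not increase during a round, whatever the cop does, so moving to the
-- neighbour of least total potential keeps the total below ½ once it starts there; and a cop
-- within distance one would contribute at least 1 - η ≥ ½. Over a uniformly random starting
-- vertex the expected total is k (1 - μ/2)ⁿ with μ = η (1 - α)ᵀ. If T ≤ (1 - ε) ½ n ln n, then
-- n μ exceeds a fixed positive power of n, so this expectation is tiny for polynomially many cops.
module Submission where

-- Origin of `α` and of the factor ½. If a cop is at distance `e` once it has moved, then `e`
-- neighbours of the robber are nearer to it and `n - e` are farther, so with `ℓ = 1 - μ` the
-- average weight is `ℓᵉ⁺¹ (1 + (e / n) (ℓ⁻² - 1))`, about `ℓᵉ⁺¹ (1 + 2 μ e / n)`. Before the round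
-- the cop was at distance at most `e + 1` and was weighed with the larger base `ℓ + μ α`, which
-- gives at least about `ℓᵉ⁺¹ (1 + (e + 1) μ α)`. So `α` must be about `2 / n`; the factor `1 + η`
-- absorbs the higher-order terms in `μ ≤ η`. Then `n μ` is about `η n exp (- 2 T / n)`, which stays
-- a positive power of `n` as long as `T` is at most a fixed fraction, below one, of `½ n ln n`.
--
-- No real logarithm or exponential is formed: `y ≤ln n` enters only through `(1 + w)ᵐ ≤ n` whenever
-- `m w ≤ y`, and Bernoulli's inequality supplies the other estimates. For a fixed `t` the loss
-- `2 / (t + 2)` is achieved once `n` passes a bound depending on `t`; letting `t` grow slowly with
-- `n` makes the loss vanish.

open import Defs
open import Algebra using (CommutativeRing)
open import Data.Bool using (true; false; not)
import Data.Integer as ℤ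
import Data.Integer.Properties as ℤₚ
open import Data.List as List using (List; []; _∷_; _++_; length)
import Data.List.Properties as Listₚ
open import Data.List.Relation.Unary.All as All using (All; []; _∷_)
import Data.List.Relation.Unary.All.Properties as Allₚ
open import Data.Nat as ℕ using (ℕ; zero; suc; z≤n; s≤s)
import Data.Nat.DivMod as ℕ/
import Data.Nat.Properties as ℕₚ
open import Data.Product using (Σ; _×_; _,_; proj₁; proj₂)
open import Data.Rational using (ℚ; mkℚ; 0ℚ; 1ℚ; ½; _+_; _*_; _-_; -_; _/_; _≤_; _<_; positive; nonNegative; toℚᵘ)
open import Data.Rational.Properties
import Data.Rational.Unnormalised as ℚᵘ
import Data.Rational.Unnormalised.Properties as ℚᵘₚ
open import Data.Sum using (_⊎_; inj₁; inj₂)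
open import Data.Vec using ([]; _∷_; replicate)
import Data.Vec.Relation.Binary.Pointwise.Inductive as Pointwise
open Pointwise using ([]; _∷_)
open import Data.Vec.Relation.Unary.Any using (Any; here; there)
open import Function using (_∘_)
open import Relation.Binary.Bundles using (DecTotalOrder)
open import Relation.Binary.PropositionalEquality hiding ([_])
open import Relation.Nullary using (¬_; Dec; yes; no; contradiction)
open import Relation.Nullary.Decidable using (dec⇒maybe)
open import Tactic.RingSolver using (solve-∀)
open import Tactic.RingSolver.Core.AlmostCommutativeRing using (AlmostCommutativeRing; fromCommutativeRing)

open import Algebra.Properties.CommutativeSemiring.Exp (CommutativeRing.commutativeSemiring +-*-commutativeRing)
  using (_^_; ^-assocʳ; ^-distrib-*)
open import Data.List.Extrema (DecTotalOrder.totalOrder ≤-decTotalOrder) using (argmin; argmin-all; f[argmin]≤f[xs])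

-- Ordered field arithmetic

ℚ-ring : AlmostCommutativeRing _ _
ℚ-ring = fromCommutativeRing +-*-commutativeRing λ x → dec⇒maybe (0ℚ ≟ x)

2ℚ : ℚ
2ℚ = 1ℚ + 1ℚ

0≤1 : 0ℚ ≤ 1ℚ
0≤1 = nonNegative⁻¹ 1ℚ

0≤½ : 0ℚ ≤ ½
0≤½ = nonNegative⁻¹ ½

0≤2 : 0ℚ ≤ 2ℚ
0≤2 = nonNegative⁻¹ 2ℚ

≤-by : ∀ {p q} d → 0ℚ ≤ d → q ≡ p + d → p ≤ q
≤-by {p} {q} d 0≤d eq = begin
  p       ≡⟨ +-identityʳ p ⟨
  p + 0ℚ  ≤⟨ +-monoʳ-≤ p 0≤d ⟩
  p + d   ≡⟨ eq ⟨
  q       ∎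
  where open ≤-Reasoning

p≤q⇒0≤q-p : ∀ {p q} → p ≤ q → 0ℚ ≤ q - p
p≤q⇒0≤q-p {p} {q} p≤q = begin
  0ℚ     ≡⟨ +-inverseʳ p ⟨
  p - p  ≤⟨ +-monoˡ-≤ (- p) p≤q ⟩
  q - p  ∎
  where open ≤-Reasoning

0≤+ : ∀ {p q} → 0ℚ ≤ p → 0ℚ ≤ q → 0ℚ ≤ p + q
0≤+ 0≤p 0≤q = +-mono-≤ 0≤p 0≤q

*-mono-≤ : ∀ {p q r s} → 0ℚ ≤ p → 0ℚ ≤ r → p ≤ q → r ≤ s → p * r ≤ q * s
*-mono-≤ {p} {q} {r} {s} 0≤p 0≤r p≤q r≤s = ≤-trans
  (*-monoʳ-≤-nonNeg r {{nonNegative 0≤r}} p≤q)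
  (*-monoˡ-≤-nonNeg q {{nonNegative (≤-trans 0≤p p≤q)}} r≤s)

0≤* : ∀ {p q} → 0ℚ ≤ p → 0ℚ ≤ q → 0ℚ ≤ p * q
0≤* {p} {q} 0≤p 0≤q = subst (_≤ p * q) (*-zeroˡ 0ℚ) (*-mono-≤ ≤-refl ≤-refl 0≤p 0≤q)

0<* : ∀ {p q} → 0ℚ < p → 0ℚ < q → 0ℚ < p * q
0<* {p} {q} 0<p 0<q = subst (_< p * q) (*-zeroˡ q) (*-monoˡ-<-pos q {{positive 0<q}} 0<p)

*-monoˡ : ∀ {p q} r → 0ℚ ≤ r → p ≤ q → r * p ≤ r * q
*-monoˡ r 0≤r = *-monoˡ-≤-nonNeg r {{nonNegative 0≤r}}

*-monoʳ : ∀ {p q} r → 0ℚ ≤ r → p ≤ q → p * r ≤ q * r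
*-monoʳ r 0≤r = *-monoʳ-≤-nonNeg r {{nonNegative 0≤r}}

0≤^ : ∀ {p} n → 0ℚ ≤ p → 0ℚ ≤ p ^ n
0≤^ zero    0≤p = 0≤1
0≤^ (suc n) 0≤p = 0≤* 0≤p (0≤^ n 0≤p)

0<^ : ∀ {p} n → 0ℚ < p → 0ℚ < p ^ n
0<^ zero    0<p = positive⁻¹ 1ℚ
0<^ (suc n) 0<p = 0<* 0<p (0<^ n 0<p)

^-monoˡ-≤ : ∀ {p q} n → 0ℚ ≤ p → p ≤ q → p ^ n ≤ q ^ n
^-monoˡ-≤ zero    0≤p p≤q = ≤-refl
^-monoˡ-≤ (suc n) 0≤p p≤q = *-mono-≤ 0≤p (0≤^ n 0≤p) p≤q (^-monoˡ-≤ n 0≤p p≤q)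

1^n≡1 : ∀ n → 1ℚ ^ n ≡ 1ℚ
1^n≡1 zero    = refl
1^n≡1 (suc n) = trans (*-identityˡ _) (1^n≡1 n)

1≤^ : ∀ {p} n → 1ℚ ≤ p → 1ℚ ≤ p ^ n
1≤^ {p} n 1≤p = subst (_≤ p ^ n) (1^n≡1 n) (^-monoˡ-≤ n 0≤1 1≤p)

^≤1 : ∀ {p} n → 0ℚ ≤ p → p ≤ 1ℚ → p ^ n ≤ 1ℚ
^≤1 {p} n 0≤p p≤1 = subst (p ^ n ≤_) (1^n≡1 n) (^-monoˡ-≤ n 0≤p p≤1)

^-antimonoʳ-≤ : ∀ {p m n} → 0ℚ ≤ p → p ≤ 1ℚ → m ℕ.≤ n → p ^ n ≤ p ^ m
^-antimonoʳ-≤ {n = n} 0≤p p≤1 ℕ.z≤n = ^≤1 n 0≤p p≤1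
^-antimonoʳ-≤ {p} 0≤p p≤1 (ℕ.s≤s m≤n) = *-monoˡ p 0≤p (^-antimonoʳ-≤ 0≤p p≤1 m≤n)

^-monoʳ-≤ : ∀ {p m n} → 1ℚ ≤ p → m ℕ.≤ n → p ^ m ≤ p ^ n
^-monoʳ-≤ {n = n} 1≤p ℕ.z≤n = 1≤^ n 1≤p
^-monoʳ-≤ {p} 1≤p (ℕ.s≤s m≤n) = *-monoˡ p (≤-trans 0≤1 1≤p) (^-monoʳ-≤ 1≤p m≤n)

-- Natural numbers and unit fractions in the rationals

toℚᵘ-fromℕ : ∀ m → toℚᵘ (fromℕ m) ℚᵘ.≃ ℚᵘ.mkℚᵘ (ℤ.+ m) 0
toℚᵘ-fromℕ m = toℚᵘ-fromℚᵘ (ℚᵘ.mkℚᵘ (ℤ.+ m) 0)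

fromℕ-suc : ∀ m → fromℕ (suc m) ≡ 1ℚ + fromℕ m
fromℕ-suc m = toℚᵘ-injective (begin
  toℚᵘ (fromℕ (suc m))                     ≈⟨ toℚᵘ-fromℕ (suc m) ⟩
  ℚᵘ.mkℚᵘ (ℤ.+ suc m) 0                    ≡⟨ cong (λ i → ℚᵘ.mkℚᵘ (ℤ.+ suc i) 0) (sym (ℕₚ.*-identityʳ m)) ⟩
  ℚᵘ.mkℚᵘ (ℤ.+ suc (m ℕ.* 1)) 0            ≡⟨ cong (λ i → ℚᵘ.mkℚᵘ (ℤ.1ℤ ℤ.+ i) 0) (ℤₚ.pos-* m 1) ⟩
  ℚᵘ.1ℚᵘ ℚᵘ.+ ℚᵘ.mkℚᵘ (ℤ.+ m) 0            ≈⟨ ℚᵘₚ.+-congʳ ℚᵘ.1ℚᵘ (toℚᵘ-fromℕ m) ⟨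
  toℚᵘ 1ℚ ℚᵘ.+ toℚᵘ (fromℕ m)              ≈⟨ toℚᵘ-homo-+ 1ℚ (fromℕ m) ⟨
  toℚᵘ (1ℚ + fromℕ m)                      ∎)
  where open ℚᵘₚ.≃-Reasoning

fromℕ-+ : ∀ m n → fromℕ (m ℕ.+ n) ≡ fromℕ m + fromℕ n
fromℕ-+ zero    n = sym (+-identityˡ (fromℕ n))
fromℕ-+ (suc m) n = begin
  fromℕ (suc (m ℕ.+ n))     ≡⟨ fromℕ-suc (m ℕ.+ n) ⟩
  1ℚ + fromℕ (m ℕ.+ n)      ≡⟨ cong (1ℚ +_) (fromℕ-+ m n) ⟩
  1ℚ + (fromℕ m + fromℕ n)  ≡⟨ +-assoc 1ℚ (fromℕ m) (fromℕ n) ⟨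
  1ℚ + fromℕ m + fromℕ n    ≡⟨ cong (_+ fromℕ n) (fromℕ-suc m) ⟨
  fromℕ (suc m) + fromℕ n   ∎
  where open ≡-Reasoning

fromℕ-* : ∀ m n → fromℕ (m ℕ.* n) ≡ fromℕ m * fromℕ n
fromℕ-* zero    n = sym (*-zeroˡ (fromℕ n))
fromℕ-* (suc m) n = begin
  fromℕ (n ℕ.+ m ℕ.* n)         ≡⟨ fromℕ-+ n (m ℕ.* n) ⟩
  fromℕ n + fromℕ (m ℕ.* n)     ≡⟨ cong (fromℕ n +_) (fromℕ-* m n) ⟩
  fromℕ n + fromℕ m * fromℕ n   ≡⟨ distrib (fromℕ m) (fromℕ n) ⟩
  (1ℚ + fromℕ m) * fromℕ n      ≡⟨ cong (_* fromℕ n) (fromℕ-suc m) ⟨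
  fromℕ (suc m) * fromℕ n       ∎
  where
  open ≡-Reasoning
  distrib : ∀ x y → y + x * y ≡ (1ℚ + x) * y
  distrib = solve-∀ ℚ-ring

fromℕ-^ : ∀ m n → fromℕ (m ℕ.^ n) ≡ fromℕ m ^ n
fromℕ-^ m zero    = refl
fromℕ-^ m (suc n) = trans (fromℕ-* m (m ℕ.^ n)) (cong (fromℕ m *_) (fromℕ-^ m n))

0≤fromℕ : ∀ m → 0ℚ ≤ fromℕ m
0≤fromℕ zero    = ≤-refl
0≤fromℕ (suc m) = subst (0ℚ ≤_) (sym (fromℕ-suc m)) (0≤+ 0≤1 (0≤fromℕ m))

fromℕ-mono-≤ : ∀ {m n} → m ℕ.≤ n → fromℕ m ≤ fromℕ n
fromℕ-mono-≤ {n = n} ℕ.z≤n = 0≤fromℕ n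
fromℕ-mono-≤ {suc m} {suc n} (ℕ.s≤s m≤n) = subst₂ _≤_ (sym (fromℕ-suc m)) (sym (fromℕ-suc n))
  (+-monoʳ-≤ 1ℚ (fromℕ-mono-≤ m≤n))

fromℕ-mono-< : ∀ {m n} → m ℕ.< n → fromℕ m < fromℕ n
fromℕ-mono-< {m} {n} m<n = <-≤-trans
  (subst₂ _<_ (+-identityˡ (fromℕ m)) (sym (fromℕ-suc m)) (+-monoˡ-< (fromℕ m) (positive⁻¹ 1ℚ)))
  (fromℕ-mono-≤ m<n)

fromℕ-cancel-≤ : ∀ {m n} → fromℕ m ≤ fromℕ n → m ℕ.≤ n
fromℕ-cancel-≤ {m} {n} le = ℕₚ.≮⇒≥ λ n<m → <-irrefl refl (<-≤-trans (fromℕ-mono-< n<m) le)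

1/suc : ℕ → ℚ
1/suc k = ℤ.+ 1 / suc k

0≤1/suc : ∀ k → 0ℚ ≤ 1/suc k
0≤1/suc k = nonNegative⁻¹ (1/suc k) {{normalize-nonNeg 1 (suc k)}}

suc*1/suc : ∀ k → fromℕ (suc k) * 1/suc k ≡ 1ℚ
suc*1/suc k = toℚᵘ-injective (begin
  toℚᵘ (fromℕ (suc k) * 1/suc k)                       ≈⟨ toℚᵘ-homo-* (fromℕ (suc k)) (1/suc k) ⟩
  toℚᵘ (fromℕ (suc k)) ℚᵘ.* toℚᵘ (1/suc k)             ≈⟨ ℚᵘₚ.*-cong (toℚᵘ-fromℕ (suc k)) (toℚᵘ-fromℚᵘ (ℚᵘ.mkℚᵘ (ℤ.+ 1) k)) ⟩
  ℚᵘ.mkℚᵘ (ℤ.+ suc k) 0 ℚᵘ.* ℚᵘ.mkℚᵘ (ℤ.+ 1) k         ≈⟨ ℚᵘ.*≡* (cong (λ i → ℤ.+ suc i) k*1*1≡k+0+0) ⟩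
  ℚᵘ.1ℚᵘ                                               ∎)
  where
  open ℚᵘₚ.≃-Reasoning
  k*1*1≡k+0+0 : k ℕ.* 1 ℕ.* 1 ≡ k ℕ.+ 0 ℕ.+ 0
  k*1*1≡k+0+0 rewrite ℕₚ.*-identityʳ k | ℕₚ.*-identityʳ k | ℕₚ.+-identityʳ k = sym (ℕₚ.+-identityʳ k)

-- Multiplying the inductive bound by `b + δ` leaves the surplus `fromℕ (suc n) * b ^ n * (δ * δ)`.
-- The homogeneous form serves `b = ℓ` without a division, and the sign of `δ` is left open because
-- `- α` is substituted later.
bernoulli : ∀ n {b δ} → 0ℚ ≤ b → 0ℚ ≤ b + δ → b ^ suc n + fromℕ (suc n) * b ^ n * δ ≤ (b + δ) ^ suc n
bernoulli zero    {b} {δ} 0≤b 0≤b+δ = ≤-reflexive (base b δ)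
  where
  base : ∀ b δ → b * 1ℚ + 1ℚ * 1ℚ * δ ≡ (b + δ) * 1ℚ
  base = solve-∀ ℚ-ring
bernoulli (suc n) {b} {δ} 0≤b 0≤b+δ = begin
  b ^ suc (suc n) + fromℕ (suc (suc n)) * b ^ suc n * δ
    ≤⟨ ≤-by (fromℕ (suc n) * b ^ n * (δ * δ)) (0≤* (0≤* (0≤fromℕ (suc n)) (0≤^ n 0≤b)) (0≤² δ))
        (trans (expand b δ (b ^ n) (fromℕ (suc n)))
          (cong (λ m → b ^ suc (suc n) + m * b ^ suc n * δ + fromℕ (suc n) * b ^ n * (δ * δ)) (sym (fromℕ-suc (suc n))))) ⟩
  (b + δ) * (b ^ suc n + fromℕ (suc n) * b ^ n * δ)
    ≤⟨ *-monoˡ (b + δ) 0≤b+δ (bernoulli n 0≤b 0≤b+δ) ⟩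
  (b + δ) ^ suc (suc n) ∎
  where
  open ≤-Reasoning
  0≤² : ∀ δ → 0ℚ ≤ δ * δ
  0≤² δ with ≤-total 0ℚ δ
  ... | inj₁ 0≤δ = 0≤* 0≤δ 0≤δ
  ... | inj₂ δ≤0 = subst (0ℚ ≤_) (neg² δ) (0≤* (neg-antimono-≤ δ≤0) (neg-antimono-≤ δ≤0))
    where
    neg² : ∀ δ → (- δ) * (- δ) ≡ δ * δ
    neg² = solve-∀ ℚ-ring
  expand : ∀ b δ bⁿ m → (b + δ) * (b * bⁿ + m * bⁿ * δ) ≡ b * (b * bⁿ) + (1ℚ + m) * (b * bⁿ) * δ + m * bⁿ * (δ * δ)
  expand = solve-∀ ℚ-ring

bernoulli₁ : ∀ n {x} → 0ℚ ≤ 1ℚ + x → 1ℚ + fromℕ n * x ≤ (1ℚ + x) ^ n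
bernoulli₁ zero    {x} 0≤1+x = ≤-reflexive (trans (cong (1ℚ +_) (*-zeroˡ x)) (+-identityʳ 1ℚ))
bernoulli₁ (suc n) {x} 0≤1+x = subst (_≤ (1ℚ + x) ^ suc n)
  (cong₂ (λ a b → a + b * x) (1^n≡1 (suc n)) (trans (cong (fromℕ (suc n) *_) (1^n≡1 n)) (*-identityʳ (fromℕ (suc n)))))
  (bernoulli n 0≤1 0≤1+x)

-- The potential

sumOver : ∀ {A : Set} → (A → ℚ) → List A → ℚ
sumOver f []       = 0ℚ
sumOver f (x ∷ xs) = f x + sumOver f xs

sumOver-++ : ∀ {A : Set} (f : A → ℚ) xs ys → sumOver f (xs ++ ys) ≡ sumOver f xs + sumOver f ys
sumOver-++ f []       ys = sym (+-identityˡ _)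
sumOver-++ f (x ∷ xs) ys = trans (cong (f x +_) (sumOver-++ f xs ys)) (sym (+-assoc (f x) _ _))

sumOver-map : ∀ {A B : Set} (f : B → ℚ) (g : A → B) xs → sumOver f (List.map g xs) ≡ sumOver (f ∘ g) xs
sumOver-map f g []       = refl
sumOver-map f g (x ∷ xs) = cong (f (g x) +_) (sumOver-map f g xs)

sumOver-+ : ∀ {A : Set} (f g : A → ℚ) xs → sumOver (λ x → f x + g x) xs ≡ sumOver f xs + sumOver g xs
sumOver-+ f g []       = refl
sumOver-+ f g (x ∷ xs) = trans (cong (f x + g x +_) (sumOver-+ f g xs)) (swap (f x) (g x) (sumOver f xs) (sumOver g xs))
  where
  swap : ∀ a b c d → a + b + (c + d) ≡ a + c + (b + d)
  swap = solve-∀ ℚ-ring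

sumOver-*ˡ : ∀ {A : Set} c (f : A → ℚ) xs → sumOver (λ x → c * f x) xs ≡ c * sumOver f xs
sumOver-*ˡ c f []       = sym (*-zeroʳ c)
sumOver-*ˡ c f (x ∷ xs) = trans (cong (c * f x +_) (sumOver-*ˡ c f xs)) (sym (*-distribˡ-+ c (f x) _))

sumOver-0 : ∀ {A : Set} (xs : List A) → sumOver (λ _ → 0ℚ) xs ≡ 0ℚ
sumOver-0 []       = refl
sumOver-0 (x ∷ xs) = trans (+-identityˡ _) (sumOver-0 xs)

length*≤sumOver : ∀ {A : Set} {c} (f : A → ℚ) {xs} → All (λ x → c ≤ f x) xs → fromℕ (length xs) * c ≤ sumOver f xs
length*≤sumOver {c = c} f []                        = ≤-reflexive (*-zeroˡ c)
length*≤sumOver {c = c} f {x ∷ xs} (c≤fx ∷ c≤fxs) = begin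
  fromℕ (suc (length xs)) * c     ≡⟨ cong (_* c) (fromℕ-suc (length xs)) ⟩
  (1ℚ + fromℕ (length xs)) * c    ≡⟨ distrib (fromℕ (length xs)) c ⟩
  c + fromℕ (length xs) * c       ≤⟨ +-mono-≤ c≤fx (length*≤sumOver f c≤fxs) ⟩
  f x + sumOver f xs              ∎
  where
  open ≤-Reasoning
  distrib : ∀ x y → (1ℚ + x) * y ≡ y + x * y
  distrib = solve-∀ ℚ-ring

-- Neighbours, vertices and Hamming distance in the hypercube

neighbours : ∀ {n} → V n → List (V n)
neighbours []      = []
neighbours (b ∷ v) = (not b ∷ v) ∷ List.map (b ∷_) (neighbours v)

vertices : ∀ n → List (V n)
vertices zero    = [] ∷ []
vertices (suc n) = List.map (true ∷_) (vertices n) ++ List.map (false ∷_) (vertices n)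

length-neighbours : ∀ {n} (v : V n) → length (neighbours v) ≡ n
length-neighbours []      = refl
length-neighbours (b ∷ v) = cong suc (trans (Listₚ.length-map (b ∷_) (neighbours v)) (length-neighbours v))

length-vertices : ∀ n → fromℕ (length (vertices n)) ≡ 2ℚ ^ n
length-vertices zero    = refl
length-vertices (suc n) = begin
  fromℕ (length (List.map (true ∷_) vs ++ List.map (false ∷_) vs))
    ≡⟨ cong fromℕ (Listₚ.length-++ (List.map (true ∷_) vs)) ⟩
  fromℕ (length (List.map (true ∷_) vs) ℕ.+ length (List.map (false ∷_) vs))
    ≡⟨ cong₂ (λ a b → fromℕ (a ℕ.+ b)) (Listₚ.length-map (true ∷_) vs) (Listₚ.length-map (false ∷_) vs) ⟩
  fromℕ (length vs ℕ.+ length vs)            ≡⟨ fromℕ-+ (length vs) (length vs) ⟩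
  fromℕ (length vs) + fromℕ (length vs)      ≡⟨ cong (λ a → a + a) (length-vertices n) ⟩
  2ℚ ^ n + 2ℚ ^ n                            ≡⟨ double (2ℚ ^ n) ⟩
  2ℚ * 2ℚ ^ n                                ∎
  where
  open ≡-Reasoning
  vs = vertices n
  double : ∀ x → x + x ≡ (1ℚ + 1ℚ) * x
  double = solve-∀ ℚ-ring

hamming-refl : ∀ {n} (v : V n) → hamming v v ≡ 0
hamming-refl []          = refl
hamming-refl (true ∷ v)  = hamming-refl v
hamming-refl (false ∷ v) = hamming-refl v

hamming-triangle : ∀ {n} (u v w : V n) → hamming u w ℕ.≤ hamming u v ℕ.+ hamming v w
hamming-triangle [] [] [] = z≤n
hamming-triangle (true ∷ u) (true ∷ v) (true ∷ w) = hamming-triangle u v w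
hamming-triangle (true ∷ u) (true ∷ v) (false ∷ w) rewrite ℕₚ.+-suc (hamming u v) (hamming v w) = s≤s (hamming-triangle u v w)
hamming-triangle (true ∷ u) (false ∷ v) (true ∷ w) = ℕₚ.m≤n⇒m≤1+n (ℕₚ.≤-trans (hamming-triangle u v w) (ℕₚ.+-monoʳ-≤ (hamming u v) (ℕₚ.n≤1+n _)))
hamming-triangle (true ∷ u) (false ∷ v) (false ∷ w) = s≤s (hamming-triangle u v w)
hamming-triangle (false ∷ u) (true ∷ v) (true ∷ w) = s≤s (hamming-triangle u v w)
hamming-triangle (false ∷ u) (true ∷ v) (false ∷ w) = ℕₚ.m≤n⇒m≤1+n (ℕₚ.≤-trans (hamming-triangle u v w) (ℕₚ.+-monoʳ-≤ (hamming u v) (ℕₚ.n≤1+n _)))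
hamming-triangle (false ∷ u) (false ∷ v) (true ∷ w) rewrite ℕₚ.+-suc (hamming u v) (hamming v w) = s≤s (hamming-triangle u v w)
hamming-triangle (false ∷ u) (false ∷ v) (false ∷ w) = hamming-triangle u v w

move⇒hamming≤1 : ∀ {n} {u v : V n} → Move u v → hamming u v ℕ.≤ 1
move⇒hamming≤1 {u = u} (inj₁ refl) rewrite hamming-refl u = z≤n
move⇒hamming≤1 (inj₂ adj) = ℕₚ.≤-reflexive adj

move⇒hamming≤ : ∀ {n} {u v : V n} (w : V n) → Move u v → hamming u w ℕ.≤ suc (hamming v w)
move⇒hamming≤ {u = u} {v} w m = ℕₚ.≤-trans (hamming-triangle u v w) (ℕₚ.+-monoˡ-≤ (hamming v w) (move⇒hamming≤1 m))

neighbours-adj : ∀ {n} (v : V n) → All (Adj v) (neighbours v)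
neighbours-adj []          = []
neighbours-adj (true ∷ v)  = cong suc (hamming-refl v) ∷ Allₚ.map⁺ (neighbours-adj v)
neighbours-adj (false ∷ v) = cong suc (hamming-refl v) ∷ Allₚ.map⁺ (neighbours-adj v)

-- With `e = hamming x r`, flipping one of the `e` differing coordinates gives distance `e - 1` and
-- flipping any other gives `e + 1`, so the sum is `e ℓᵉ⁻¹ + (n - e) ℓᵉ⁺¹`. The extra factor `ℓ`
-- keeps the exponent `e - 1` out of the formula.
neighbour-sum : ∀ {n} ℓ (x r : V n) →
  ℓ * sumOver (λ v → ℓ ^ hamming x v) (neighbours r) ≡
  ℓ ^ hamming x r * (fromℕ n * (ℓ * ℓ) + fromℕ (hamming x r) * (1ℚ - ℓ * ℓ))
neighbour-sum ℓ [] [] = base ℓ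
  where
  base : ∀ ℓ → ℓ * 0ℚ ≡ 1ℚ * (0ℚ * (ℓ * ℓ) + 0ℚ * (1ℚ - ℓ * ℓ))
  base = solve-∀ ℚ-ring
neighbour-sum {suc n} ℓ (a ∷ x) (b ∷ r) = go a b
  where
  open ≡-Reasoning
  e = hamming x r
  S = sumOver (λ v → ℓ ^ hamming x v) (neighbours r)
  same : ℓ * (ℓ * ℓ ^ e + S) ≡ ℓ ^ e * (fromℕ (suc n) * (ℓ * ℓ) + fromℕ e * (1ℚ - ℓ * ℓ))
  same = begin
    ℓ * (ℓ * ℓ ^ e + S)                 ≡⟨ *-distribˡ-+ ℓ (ℓ * ℓ ^ e) S ⟩
    ℓ * (ℓ * ℓ ^ e) + ℓ * S             ≡⟨ cong (ℓ * (ℓ * ℓ ^ e) +_) (neighbour-sum ℓ x r) ⟩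
    ℓ * (ℓ * ℓ ^ e) + ℓ ^ e * (fromℕ n * (ℓ * ℓ) + fromℕ e * (1ℚ - ℓ * ℓ))
      ≡⟨ ring ℓ (ℓ ^ e) (fromℕ n) (fromℕ e) ⟩
    ℓ ^ e * ((1ℚ + fromℕ n) * (ℓ * ℓ) + fromℕ e * (1ℚ - ℓ * ℓ))
      ≡⟨ cong (λ m → ℓ ^ e * (m * (ℓ * ℓ) + fromℕ e * (1ℚ - ℓ * ℓ))) (sym (fromℕ-suc n)) ⟩
    ℓ ^ e * (fromℕ (suc n) * (ℓ * ℓ) + fromℕ e * (1ℚ - ℓ * ℓ)) ∎
    where
    ring : ∀ ℓ p n e → ℓ * (ℓ * p) + p * (n * (ℓ * ℓ) + e * (1ℚ - ℓ * ℓ)) ≡ p * ((1ℚ + n) * (ℓ * ℓ) + e * (1ℚ - ℓ * ℓ))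
    ring = solve-∀ ℚ-ring
  differ : ℓ * (ℓ ^ e + ℓ * S) ≡ ℓ ^ suc e * (fromℕ (suc n) * (ℓ * ℓ) + fromℕ (suc e) * (1ℚ - ℓ * ℓ))
  differ = begin
    ℓ * (ℓ ^ e + ℓ * S)
      ≡⟨ cong (λ s → ℓ * (ℓ ^ e + s)) (neighbour-sum ℓ x r) ⟩
    ℓ * (ℓ ^ e + ℓ ^ e * (fromℕ n * (ℓ * ℓ) + fromℕ e * (1ℚ - ℓ * ℓ)))
      ≡⟨ ring ℓ (ℓ ^ e) (fromℕ n) (fromℕ e) ⟩
    ℓ ^ suc e * ((1ℚ + fromℕ n) * (ℓ * ℓ) + (1ℚ + fromℕ e) * (1ℚ - ℓ * ℓ))
      ≡⟨ cong₂ (λ m d → ℓ ^ suc e * (m * (ℓ * ℓ) + d * (1ℚ - ℓ * ℓ))) (sym (fromℕ-suc n)) (sym (fromℕ-suc e)) ⟩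
    ℓ ^ suc e * (fromℕ (suc n) * (ℓ * ℓ) + fromℕ (suc e) * (1ℚ - ℓ * ℓ)) ∎
    where
    ring : ∀ ℓ p n e → ℓ * (p + p * (n * (ℓ * ℓ) + e * (1ℚ - ℓ * ℓ))) ≡ ℓ * p * ((1ℚ + n) * (ℓ * ℓ) + (1ℚ + e) * (1ℚ - ℓ * ℓ))
    ring = solve-∀ ℚ-ring
  go : ∀ a b → ℓ * sumOver (λ v → ℓ ^ hamming (a ∷ x) v) (neighbours (b ∷ r)) ≡
       ℓ ^ hamming (a ∷ x) (b ∷ r) * (fromℕ (suc n) * (ℓ * ℓ) + fromℕ (hamming (a ∷ x) (b ∷ r)) * (1ℚ - ℓ * ℓ))
  go true  true  = trans (cong (λ s → ℓ * (ℓ * ℓ ^ e + s)) (sumOver-map _ (true ∷_) (neighbours r))) same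
  go false false = trans (cong (λ s → ℓ * (ℓ * ℓ ^ e + s)) (sumOver-map _ (false ∷_) (neighbours r))) same
  go true  false = trans (cong (λ s → ℓ * (ℓ ^ e + s)) (trans (sumOver-map _ (false ∷_) (neighbours r)) (sumOver-*ˡ ℓ _ (neighbours r)))) differ
  go false true  = trans (cong (λ s → ℓ * (ℓ ^ e + s)) (trans (sumOver-map _ (true ∷_) (neighbours r)) (sumOver-*ˡ ℓ _ (neighbours r)))) differ

-- The weight factors over the coordinates, each contributing `1ℚ` for agreement and `ℓ` for
-- disagreement; hence the total is the same for every position of the cop.
vertex-sum : ∀ {n} ℓ (x : V n) → sumOver (λ v → ℓ ^ hamming x v) (vertices n) ≡ (1ℚ + ℓ) ^ n
vertex-sum         ℓ []      = refl
vertex-sum {suc n} ℓ (a ∷ x) = begin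
  sumOver f (List.map (true ∷_) vs ++ List.map (false ∷_) vs)
    ≡⟨ sumOver-++ f (List.map (true ∷_) vs) _ ⟩
  sumOver f (List.map (true ∷_) vs) + sumOver f (List.map (false ∷_) vs)
    ≡⟨ cong₂ _+_ (sumOver-map f (true ∷_) vs) (sumOver-map f (false ∷_) vs) ⟩
  sumOver (f ∘ (true ∷_)) vs + sumOver (f ∘ (false ∷_)) vs
    ≡⟨ halves a ⟩
  S + ℓ * S
    ≡⟨ cong (λ s → s + ℓ * s) (vertex-sum ℓ x) ⟩
  (1ℚ + ℓ) ^ n + ℓ * (1ℚ + ℓ) ^ n
    ≡⟨ factor ℓ ((1ℚ + ℓ) ^ n) ⟩
  (1ℚ + ℓ) ^ suc n ∎
  where
  open ≡-Reasoning
  vs = vertices n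
  f = λ v → ℓ ^ hamming (a ∷ x) v
  S = sumOver (λ v → ℓ ^ hamming x v) vs
  halves : ∀ a → sumOver (λ v → ℓ ^ hamming (a ∷ x) (true ∷ v)) vs + sumOver (λ v → ℓ ^ hamming (a ∷ x) (false ∷ v)) vs ≡ S + ℓ * S
  halves true  = cong (S +_) (sumOver-*ˡ ℓ _ vs)
  halves false = trans (+-comm _ S) (cong (S +_) (sumOver-*ˡ ℓ _ vs))
  factor : ∀ ℓ p → p + ℓ * p ≡ (1ℚ + ℓ) * p
  factor = solve-∀ ℚ-ring

-- The potential of a configuration and its averages

potential : ∀ {n k} → ℚ → Config n k → V n → ℚ
potential ℓ []      r = 0ℚ
potential ℓ (x ∷ c) r = ℓ ^ hamming x r + potential ℓ c r

0≤potential : ∀ {n k ℓ} → 0ℚ ≤ ℓ → (c : Config n k) (r : V n) → 0ℚ ≤ potential ℓ c r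
0≤potential 0≤ℓ []      r = ≤-refl
0≤potential 0≤ℓ (x ∷ c) r = 0≤+ (0≤^ (hamming x r) 0≤ℓ) (0≤potential 0≤ℓ c r)

vertex-sum-potential : ∀ {n k} ℓ (c : Config n k) → sumOver (potential ℓ c) (vertices n) ≡ fromℕ k * (1ℚ + ℓ) ^ n
vertex-sum-potential {n}         ℓ []      = trans (sumOver-0 (vertices n)) (sym (*-zeroˡ ((1ℚ + ℓ) ^ n)))
vertex-sum-potential {n} {suc k} ℓ (x ∷ c) = begin
  sumOver (potential ℓ (x ∷ c)) (vertices n)
    ≡⟨ sumOver-+ (λ v → ℓ ^ hamming x v) (potential ℓ c) (vertices n) ⟩
  sumOver (λ v → ℓ ^ hamming x v) (vertices n) + sumOver (potential ℓ c) (vertices n)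
    ≡⟨ cong₂ _+_ (vertex-sum ℓ x) (vertex-sum-potential ℓ c) ⟩
  (1ℚ + ℓ) ^ n + fromℕ k * (1ℚ + ℓ) ^ n
    ≡⟨ factor ((1ℚ + ℓ) ^ n) (fromℕ k) ⟩
  (1ℚ + fromℕ k) * (1ℚ + ℓ) ^ n
    ≡⟨ cong (_* (1ℚ + ℓ) ^ n) (sym (fromℕ-suc k)) ⟩
  fromℕ (suc k) * (1ℚ + ℓ) ^ n ∎
  where
  open ≡-Reasoning
  factor : ∀ p k → p + k * p ≡ (1ℚ + k) * p
  factor = solve-∀ ℚ-ring

-- The first-moment argument, with the average multiplied out. The seed `v` also competes in
-- `argmin`, which can only lower the minimum.
length*best≤sumOver : ∀ {n} (f : V n → ℚ) v vs → fromℕ (length vs) * f (argmin f v vs) ≤ sumOver f vs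
length*best≤sumOver f v vs = length*≤sumOver f (f[argmin]≤f[xs] {f = f} v vs)

-- Seeding the search with the current vertex keeps every outcome legal: if the seed wins, the
-- robber passes.
move-best : ∀ {n} (f : V n → ℚ) v → Move v (argmin f v (neighbours v))
move-best f v = argmin-all f {P = Move v} (inj₁ refl) (All.map inj₂ (neighbours-adj v))

-- One round, read backwards in time: `ℓ` is the base after the round and `ℓ′` the base before it,
-- when one more round is to go. The difference `ℓ′ - ℓ = μ * α` is the budget for the cop's
-- approach.
module Step {n : ℕ} {α η μ : ℚ}
  (nα : fromℕ n * α ≡ 2ℚ * (1ℚ + η)) (0≤α : 0ℚ ≤ α) (α≤1 : α ≤ 1ℚ)
  (η≤½ : η ≤ ½) (0≤μ : 0ℚ ≤ μ) (μ≤η : μ ≤ η) where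

  ℓ ℓ′ : ℚ
  ℓ  = 1ℚ - μ
  ℓ′ = 1ℚ - μ * (1ℚ - α)

  private
    0≤η : 0ℚ ≤ η
    0≤η = ≤-trans 0≤μ μ≤η

    μ≤½ : μ ≤ ½
    μ≤½ = ≤-trans μ≤η η≤½

    0<ℓ : 0ℚ < ℓ
    0<ℓ = <-≤-trans (positive⁻¹ ½) (≤-by (½ - μ) (p≤q⇒0≤q-p μ≤½) (ring μ))
      where
      ring : ∀ μ → 1ℚ - μ ≡ ½ + (½ - μ)
      ring = solve-∀ ℚ-ring

    0≤ℓ = <⇒≤ 0<ℓ

    ℓ′≡ : ℓ′ ≡ ℓ + μ * α
    ℓ′≡ = ring μ α
      where
      ring : ∀ μ α → 1ℚ - μ * (1ℚ - α) ≡ 1ℚ - μ + μ * α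
      ring = solve-∀ ℚ-ring

    0≤ℓ+μα : 0ℚ ≤ ℓ + μ * α
    0≤ℓ+μα = 0≤+ 0≤ℓ (0≤* 0≤μ 0≤α)

    0≤ℓ′ : 0ℚ ≤ ℓ′
    0≤ℓ′ = subst (0ℚ ≤_) (sym ℓ′≡) 0≤ℓ+μα

    ℓ′≤1 : ℓ′ ≤ 1ℚ
    ℓ′≤1 = ≤-by (μ * (1ℚ - α)) (0≤* 0≤μ (p≤q⇒0≤q-p α≤1)) (ring (μ * (1ℚ - α)))
      where
      ring : ∀ z → 1ℚ ≡ 1ℚ - z + z
      ring = solve-∀ ℚ-ring

    -- As 1 - ℓ² = μ (2 - μ) ≤ μ · 2 (1 + η) (1 - μ), the first-order gain in Bernoulli's inequality
    -- pays for the e neighbours that are closer to the cop.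
    core : ∀ e (pe nn : ℚ) → 0ℚ ≤ e → 0ℚ ≤ pe → nn * α ≡ 2ℚ * (1ℚ + η) →
      pe * (nn * (ℓ * ℓ) + e * (1ℚ - ℓ * ℓ)) ≤ ℓ * (nn * (ℓ * pe + (1ℚ + e) * pe * (μ * α)))
    core e pe nn 0≤e 0≤pe eq = ≤-by (pe * (e * μ * (η - μ + η * (2ℚ * (½ - μ))) + ℓ * μ * (2ℚ * (1ℚ + η))))
      (0≤* 0≤pe (0≤+ (0≤* (0≤* 0≤e 0≤μ) (0≤+ (p≤q⇒0≤q-p μ≤η) (0≤* 0≤η (0≤* 0≤2 (p≤q⇒0≤q-p μ≤½)))))
        (0≤* (0≤* 0≤ℓ 0≤μ) (0≤* 0≤2 (0≤+ 0≤1 0≤η)))))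
      (trans (ring₁ e pe nn μ α) (trans (cong (λ z → pe * (nn * ((1ℚ - μ) * (1ℚ - μ)) + (1ℚ + e) * (1ℚ - μ) * μ * z)) eq) (ring₂ e pe nn μ η)))
      where
      ring₁ : ∀ e p n μ α → (1ℚ - μ) * (n * ((1ℚ - μ) * p + (1ℚ + e) * p * (μ * α))) ≡
        p * (n * ((1ℚ - μ) * (1ℚ - μ)) + (1ℚ + e) * (1ℚ - μ) * μ * (n * α))
      ring₁ = solve-∀ ℚ-ring
      ring₂ : ∀ e p n μ η → p * (n * ((1ℚ - μ) * (1ℚ - μ)) + (1ℚ + e) * (1ℚ - μ) * μ * ((1ℚ + 1ℚ) * (1ℚ + η))) ≡
        p * (n * ((1ℚ - μ) * (1ℚ - μ)) + e * (1ℚ - (1ℚ - μ) * (1ℚ - μ))) +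
        p * (e * μ * (η - μ + η * ((1ℚ + 1ℚ) * (½ - μ))) + (1ℚ - μ) * μ * ((1ℚ + 1ℚ) * (1ℚ + η)))
      ring₂ = solve-∀ ℚ-ring

  -- The cop's choice enters only through `hamming x r ≤ suc e`, where `e` is its distance after
  -- moving. As `0 ≤ ℓ′ ≤ 1`, the exponent `suc e`, a full step towards the robber, is the worst
  -- case, and there Bernoulli's first-order term is enough.
  neighbour-sum≤ : ∀ {x x′ : V n} (r : V n) → Move x x′ →
    sumOver (λ v → ℓ ^ hamming x′ v) (neighbours r) ≤ fromℕ n * ℓ′ ^ hamming x r
  neighbour-sum≤ {x} {x′} r m = *-cancelˡ-≤-pos ℓ {{positive 0<ℓ}} (begin
    ℓ * sumOver (λ v → ℓ ^ hamming x′ v) (neighbours r)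
      ≡⟨ neighbour-sum ℓ x′ r ⟩
    ℓ ^ e * (fromℕ n * (ℓ * ℓ) + fromℕ e * (1ℚ - ℓ * ℓ))
      ≤⟨ core (fromℕ e) (ℓ ^ e) (fromℕ n) (0≤fromℕ e) (0≤^ e 0≤ℓ) nα ⟩
    ℓ * (fromℕ n * (ℓ * ℓ ^ e + (1ℚ + fromℕ e) * ℓ ^ e * (μ * α)))
      ≡⟨ cong (λ d → ℓ * (fromℕ n * (ℓ * ℓ ^ e + d * ℓ ^ e * (μ * α)))) (sym (fromℕ-suc e)) ⟩
    ℓ * (fromℕ n * (ℓ ^ suc e + fromℕ (suc e) * ℓ ^ e * (μ * α)))
      ≤⟨ *-monoˡ ℓ 0≤ℓ (*-monoˡ (fromℕ n) (0≤fromℕ n) (bernoulli e 0≤ℓ 0≤ℓ+μα)) ⟩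
    ℓ * (fromℕ n * (ℓ + μ * α) ^ suc e)
      ≡⟨ cong (λ z → ℓ * (fromℕ n * z ^ suc e)) (sym ℓ′≡) ⟩
    ℓ * (fromℕ n * ℓ′ ^ suc e)
      ≤⟨ *-monoˡ ℓ 0≤ℓ (*-monoˡ (fromℕ n) (0≤fromℕ n) (^-antimonoʳ-≤ 0≤ℓ′ ℓ′≤1 (move⇒hamming≤ r m))) ⟩
    ℓ * (fromℕ n * ℓ′ ^ hamming x r) ∎)
    where
    open ≤-Reasoning
    e = hamming x′ r

  neighbour-sum-potential≤ : ∀ {k} {c c′ : Config n k} (r : V n) → CopMove c c′ →
    sumOver (potential ℓ c′) (neighbours r) ≤ fromℕ n * potential ℓ′ c r
  neighbour-sum-potential≤ r [] = ≤-reflexive (trans (sumOver-0 (neighbours r)) (sym (*-zeroʳ (fromℕ n))))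
  neighbour-sum-potential≤ {c = x ∷ c} {x′ ∷ c′} r (m ∷ ms) = begin
    sumOver (potential ℓ (x′ ∷ c′)) (neighbours r)
      ≡⟨ sumOver-+ (λ v → ℓ ^ hamming x′ v) (potential ℓ c′) (neighbours r) ⟩
    sumOver (λ v → ℓ ^ hamming x′ v) (neighbours r) + sumOver (potential ℓ c′) (neighbours r)
      ≤⟨ +-mono-≤ (neighbour-sum≤ r m) (neighbour-sum-potential≤ r ms) ⟩
    fromℕ n * ℓ′ ^ hamming x r + fromℕ n * potential ℓ′ c r
      ≡⟨ *-distribˡ-+ (fromℕ n) _ _ ⟨
    fromℕ n * potential ℓ′ (x ∷ c) r ∎
    where open ≤-Reasoning

  best-potential≤ : ∀ {k} {c c′ : Config n k} (r : V n) → 0 ℕ.< n → CopMove c c′ →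
    potential ℓ c′ (argmin (potential ℓ c′) r (neighbours r)) ≤ potential ℓ′ c r
  best-potential≤ {c = c} {c′} r 0<n ms = *-cancelˡ-≤-pos (fromℕ n) {{positive (fromℕ-mono-< 0<n)}}
    (≤-trans (subst (λ m → fromℕ m * potential ℓ c′ (argmin (potential ℓ c′) r (neighbours r)) ≤ sumOver (potential ℓ c′) (neighbours r))
               (length-neighbours r) (length*best≤sumOver (potential ℓ c′) r (neighbours r)))
             (neighbour-sum-potential≤ r ms))

-- The robber's strategy

-- `Survives` forbids capture both after the cops' move and after the robber's reply. Keeping this
-- ball free of cops before each cop move rules out both.
WithinOne : ∀ {n k} → Config n k → V n → Set
WithinOne c r = Any (λ x → hamming x r ℕ.≤ 1) c

caught-after-move : ∀ {n k} {c c′ : Config n k} {r} → CopMove c c′ → Caught c′ r → WithinOne c r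
caught-after-move (m ∷ ms) (here refl) = here (move⇒hamming≤1 m)
caught-after-move (m ∷ ms) (there any) = there (caught-after-move ms any)

withinOne⇒ℓ≤potential : ∀ {n k ℓ} {c : Config n k} {r} → 0ℚ ≤ ℓ → ℓ ≤ 1ℚ → WithinOne c r → ℓ ≤ potential ℓ c r
withinOne⇒ℓ≤potential {ℓ = ℓ} {x ∷ c} {r} 0≤ℓ ℓ≤1 (here d≤1) = begin
  ℓ                                     ≡⟨ *-identityʳ ℓ ⟨
  ℓ ^ 1                                 ≤⟨ ^-antimonoʳ-≤ 0≤ℓ ℓ≤1 d≤1 ⟩
  ℓ ^ hamming x r                       ≤⟨ ≤-by (potential ℓ c r) (0≤potential 0≤ℓ c r) refl ⟩
  ℓ ^ hamming x r + potential ℓ c r     ∎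
  where open ≤-Reasoning
withinOne⇒ℓ≤potential {ℓ = ℓ} {x ∷ c} {r} 0≤ℓ ℓ≤1 (there any) = ≤-trans
  (withinOne⇒ℓ≤potential 0≤ℓ ℓ≤1 any)
  (≤-by (ℓ ^ hamming x r) (0≤^ (hamming x r) 0≤ℓ) (+-comm (ℓ ^ hamming x r) (potential ℓ c r)))

start-potential≤ : ∀ {n k} (ℓ : ℚ) (c : Config n k) v →
  2ℚ ^ n * potential ℓ c (argmin (potential ℓ c) v (vertices n)) ≤ fromℕ k * (1ℚ + ℓ) ^ n
start-potential≤ {n} {k} ℓ c v = begin
  2ℚ ^ n * potential ℓ c best                         ≡⟨ cong (_* potential ℓ c best) (length-vertices n) ⟨
  fromℕ (length (vertices n)) * potential ℓ c best    ≤⟨ length*best≤sumOver (potential ℓ c) v (vertices n) ⟩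
  sumOver (potential ℓ c) (vertices n)                ≡⟨ vertex-sum-potential ℓ c ⟩
  fromℕ k * (1ℚ + ℓ) ^ n                              ∎
  where
  open ≤-Reasoning
  best = argmin (potential ℓ c) v (vertices n)

-- The average over all starts is `k (1 - ½ μ)ⁿ`. Since `(1 - ½ μ) (1 + ½ μ) ≤ 1`, this is below ½
-- once `(1 + ½ μ)ⁿ` exceeds `2 k`; the condition is put on the growing power because Bernoulli's
-- inequality bounds that one from below.
start-potential<½ : ∀ {n k} {μ : ℚ} (c : Config n k) v → 0ℚ ≤ μ → μ ≤ 1ℚ →
  2ℚ * fromℕ k < (1ℚ + ½ * μ) ^ n →
  potential (1ℚ - μ) c (argmin (potential (1ℚ - μ) c) v (vertices n)) < ½
start-potential<½ {n} {k} {μ} c v 0≤μ μ≤1 2k<X = ≰⇒> λ ½≤Φ → <-irrefl refl (<-≤-trans 2k<X (begin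
  X                                                   ≡⟨ halve X ⟩
  2ℚ * (½ * X)                                        ≤⟨ *-monoˡ 2ℚ 0≤2 (*-monoʳ X 0≤X ½≤Φ) ⟩
  2ℚ * (Φ * X)                                        ≤⟨ *-monoˡ 2ℚ 0≤2 (*-monoʳ X 0≤X Φ≤) ⟩
  2ℚ * (fromℕ k * (1ℚ - ½ * μ) ^ n * X)               ≡⟨ cong (2ℚ *_) (*-assoc (fromℕ k) _ X) ⟩
  2ℚ * (fromℕ k * ((1ℚ - ½ * μ) ^ n * X))             ≡⟨ cong (λ z → 2ℚ * (fromℕ k * z)) (^-distrib-* (1ℚ - ½ * μ) (1ℚ + ½ * μ) n) ⟨
  2ℚ * (fromℕ k * ((1ℚ - ½ * μ) * (1ℚ + ½ * μ)) ^ n)  ≤⟨ *-monoˡ 2ℚ 0≤2 (*-monoˡ (fromℕ k) (0≤fromℕ k) (^≤1 n (0≤* 0≤1-½μ 0≤1+½μ) prod≤1)) ⟩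
  2ℚ * (fromℕ k * 1ℚ)                                 ≡⟨ cong (2ℚ *_) (*-identityʳ (fromℕ k)) ⟩
  2ℚ * fromℕ k                                        ∎))
  where
  open ≤-Reasoning
  X = (1ℚ + ½ * μ) ^ n
  Φ = potential (1ℚ - μ) c (argmin (potential (1ℚ - μ) c) v (vertices n))
  0≤1+½μ : 0ℚ ≤ 1ℚ + ½ * μ
  0≤1+½μ = 0≤+ 0≤1 (0≤* 0≤½ 0≤μ)
  0≤1-½μ : 0ℚ ≤ 1ℚ - ½ * μ
  0≤1-½μ = subst (0ℚ ≤_) (ring μ) (0≤+ 0≤½ (0≤* 0≤½ (p≤q⇒0≤q-p μ≤1)))
    where
    ring : ∀ μ → ½ + ½ * (1ℚ - μ) ≡ 1ℚ - ½ * μ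
    ring = solve-∀ ℚ-ring
  0≤X : 0ℚ ≤ X
  0≤X = 0≤^ n 0≤1+½μ
  prod≤1 : (1ℚ - ½ * μ) * (1ℚ + ½ * μ) ≤ 1ℚ
  prod≤1 = ≤-by (½ * μ * (½ * μ)) (0≤* (0≤* 0≤½ 0≤μ) (0≤* 0≤½ 0≤μ)) (ring (½ * μ))
    where
    ring : ∀ u → 1ℚ ≡ (1ℚ - u) * (1ℚ + u) + u * u
    ring = solve-∀ ℚ-ring
  halve : ∀ x → x ≡ (1ℚ + 1ℚ) * (½ * x)
  halve = solve-∀ ℚ-ring
  Φ≤ : Φ ≤ fromℕ k * (1ℚ - ½ * μ) ^ n
  Φ≤ = *-cancelˡ-≤-pos (2ℚ ^ n) {{positive (0<^ n (positive⁻¹ 2ℚ))}} (begin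
    2ℚ ^ n * Φ                                 ≤⟨ start-potential≤ (1ℚ - μ) c v ⟩
    fromℕ k * (1ℚ + (1ℚ - μ)) ^ n              ≡⟨ cong (λ z → fromℕ k * z ^ n) (ring μ) ⟩
    fromℕ k * (2ℚ * (1ℚ - ½ * μ)) ^ n          ≡⟨ cong (fromℕ k *_) (^-distrib-* 2ℚ (1ℚ - ½ * μ) n) ⟩
    fromℕ k * (2ℚ ^ n * (1ℚ - ½ * μ) ^ n)      ≡⟨ swap (fromℕ k) (2ℚ ^ n) ((1ℚ - ½ * μ) ^ n) ⟩
    2ℚ ^ n * (fromℕ k * (1ℚ - ½ * μ) ^ n)      ∎)
    where
    ring : ∀ μ → 1ℚ + (1ℚ - μ) ≡ (1ℚ + 1ℚ) * (1ℚ - ½ * μ)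
    ring = solve-∀ ℚ-ring
    swap : ∀ a b c → a * (b * c) ≡ b * (a * c)
    swap = solve-∀ ℚ-ring

module Evasion {n k : ℕ} (0<n : 0 ℕ.< n) {α η : ℚ}
  (nα : fromℕ n * α ≡ 2ℚ * (1ℚ + η)) (0≤α : 0ℚ ≤ α) (α≤1 : α ≤ 1ℚ)
  (0≤η : 0ℚ ≤ η) (η≤½ : η ≤ ½) where

  gap : ℕ → ℚ
  gap j = η * (1ℚ - α) ^ j

  robber : ℕ → RobberStrategy n k
  robber T .rstart c = argmin (potential (1ℚ - gap T) c) (replicate n true) (vertices n)
  robber T .rmove []            c′ = replicate n true
  -- After `i` completed rounds the whole history has `suc i` entries, so `length h` is `i`, and
  -- `T ℕ.∸ suc i` rounds remain after this reply.
  robber T .rmove ((c , r) ∷ h) c′ = argmin (potential (1ℚ - gap (T ℕ.∸ suc (length h))) c′) r (neighbours r)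

  robber-legal : ∀ T → LegalRobber (robber T)
  robber-legal T c c′ r h = move-best (potential (1ℚ - gap (T ℕ.∸ suc (length h))) c′) r

  private
    0≤gap : ∀ j → 0ℚ ≤ gap j
    0≤gap j = 0≤* 0≤η (0≤^ j (p≤q⇒0≤q-p α≤1))

    gap≤η : ∀ j → gap j ≤ η
    gap≤η j = subst (gap j ≤_) (*-identityʳ η) (*-monoˡ η 0≤η
      (^≤1 j (p≤q⇒0≤q-p α≤1) (≤-by α 0≤α (ring α))))
      where
      ring : ∀ α → 1ℚ ≡ 1ℚ - α + α
      ring = solve-∀ ℚ-ring

    gap-suc : ∀ j → gap j * (1ℚ - α) ≡ gap (suc j)
    gap-suc j = ring η (1ℚ - α) ((1ℚ - α) ^ j)
      where
      ring : ∀ x y z → x * z * y ≡ x * (y * z)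
      ring = solve-∀ ℚ-ring

    gap≤1 : ∀ j → gap j ≤ 1ℚ
    gap≤1 j = ≤-trans (gap≤η j) (≤-trans η≤½ (≤-by ½ 0≤½ refl))

    ½≤1-gap : ∀ j → ½ ≤ 1ℚ - gap j
    ½≤1-gap j = ≤-by (½ - gap j) (p≤q⇒0≤q-p (≤-trans (gap≤η j) η≤½)) (ring (gap j))
      where
      ring : ∀ g → 1ℚ - g ≡ ½ + (½ - g)
      ring = solve-∀ ℚ-ring

    1-gap≤1 : ∀ j → 1ℚ - gap j ≤ 1ℚ
    1-gap≤1 j = ≤-by (gap j) (0≤gap j) (ring (gap j))
      where
      ring : ∀ g → 1ℚ ≡ 1ℚ - g + g
      ring = solve-∀ ℚ-ring

    safe : ∀ j {c : Config n k} {r} → potential (1ℚ - gap j) c r < ½ → ¬ WithinOne c r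
    safe j Φ<½ near = <-irrefl refl (≤-<-trans (½≤1-gap j)
      (≤-<-trans (withinOne⇒ℓ≤potential (≤-trans 0≤½ (½≤1-gap j)) (1-gap≤1 j) near) Φ<½))

  module _ (σ : CopStrategy n k) (legal : LegalCop σ) (T : ℕ)
    (small : 2ℚ * fromℕ k < (1ℚ + ½ * gap T) ^ n) where

    open Play σ (robber T)

    private
      length-hist : ∀ i → length (hist i) ≡ suc i
      length-hist zero    = refl
      length-hist (suc i) = cong suc (length-hist i)

      cops-move : ∀ i → CopMove (proj₁ (pos i)) (cmove σ (hist i))
      cops-move zero    = legal _ _ []
      cops-move (suc i) = legal _ _ (hist i)

      robber-move : ∀ i → proj₂ (pos (suc i)) ≡
        argmin (potential (1ℚ - gap (T ℕ.∸ suc i)) (cmove σ (hist i))) (proj₂ (pos i)) (neighbours (proj₂ (pos i)))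
      robber-move zero    = refl
      robber-move (suc i) rewrite length-hist i = refl

      Φ : ℕ → ℚ
      Φ i = potential (1ℚ - gap (T ℕ.∸ i)) (proj₁ (pos i)) (proj₂ (pos i))

      Φ-step : ∀ i → i ℕ.< T → Φ (suc i) ≤ Φ i
      Φ-step i i<T = begin
        potential (1ℚ - gap (T ℕ.∸ suc i)) (cmove σ (hist i)) (proj₂ (pos (suc i)))
          ≡⟨ cong (potential (1ℚ - gap (T ℕ.∸ suc i)) (cmove σ (hist i))) (robber-move i) ⟩
        potential (1ℚ - gap (T ℕ.∸ suc i)) (cmove σ (hist i)) (argmin (potential (1ℚ - gap (T ℕ.∸ suc i)) (cmove σ (hist i))) (proj₂ (pos i)) (neighbours (proj₂ (pos i))))
          ≤⟨ Step.best-potential≤ nα 0≤α α≤1 η≤½ (0≤gap (T ℕ.∸ suc i)) (gap≤η (T ℕ.∸ suc i)) (proj₂ (pos i)) 0<n (cops-move i) ⟩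
        potential (1ℚ - gap (T ℕ.∸ suc i) * (1ℚ - α)) (proj₁ (pos i)) (proj₂ (pos i))
          ≡⟨ cong (λ g → potential (1ℚ - g) (proj₁ (pos i)) (proj₂ (pos i))) (gap-suc (T ℕ.∸ suc i)) ⟩
        potential (1ℚ - gap (suc (T ℕ.∸ suc i))) (proj₁ (pos i)) (proj₂ (pos i))
          -- Here `i < T` makes the truncated subtraction exact: `suc (T ℕ.∸ suc i)` is `T ℕ.∸ i`.
          ≡⟨ cong (λ j → potential (1ℚ - gap j) (proj₁ (pos i)) (proj₂ (pos i))) (sym (ℕₚ.+-∸-assoc 1 i<T)) ⟩
        Φ i ∎
        where open ≤-Reasoning

      Φ<½ : ∀ i → i ℕ.≤ T → Φ i < ½
      Φ<½ zero    _   = start-potential<½ (cstart σ) (replicate n true) (0≤gap T) (gap≤1 T) small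
      Φ<½ (suc i) i<T = ≤-<-trans (Φ-step i i<T) (Φ<½ i (ℕₚ.<⇒≤ i<T))

      uncaught : ∀ i → i ℕ.≤ T → ¬ Caught (proj₁ (pos i)) (proj₂ (pos i))
      -- Capture in the current position is treated as capture after a move in which every cop
      -- passes.
      uncaught i i≤T = safe (T ℕ.∸ i) (Φ<½ i i≤T) ∘ caught-after-move (Pointwise.refl (inj₁ refl))

    survives : ∀ T′ → T′ ℕ.≤ T → Survives σ (robber T) T′
    survives T′ T′≤T = uncaught 0 z≤n , λ i i<T′ →
      let i<T = ℕₚ.<-≤-trans i<T′ T′≤T in
      (λ caught → safe (T ℕ.∸ i) (Φ<½ i (ℕₚ.<⇒≤ i<T)) (caught-after-move (cops-move i) caught)) ,
      uncaught (suc i) i<T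

-- Exponentials, bounded search and diagonalisation

0≤expTerm : ∀ {x} k → 0ℚ ≤ x → 0ℚ ≤ expTerm x k
0≤expTerm zero    0≤x = 0≤1
0≤expTerm (suc k) 0≤x = 0≤* (0≤* (0≤expTerm k 0≤x) 0≤x) (0≤1/suc k)

-- These are the first two terms in the binomial expansion of `(x + w)ᵏ⁺¹ / (k + 1)!`; the other
-- terms are nonnegative.
expTerm-+ : ∀ {x w} k → 0ℚ ≤ x → 0ℚ ≤ w → expTerm x (suc k) + w * expTerm x k ≤ expTerm (x + w) (suc k)
expTerm-+ {x} {w} zero 0≤x 0≤w = ≤-reflexive (ring x w)
  where
  ring : ∀ x w → 1ℚ * x * 1ℚ + w * 1ℚ ≡ 1ℚ * (x + w) * 1ℚ
  ring = solve-∀ ℚ-ring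
expTerm-+ {x} {w} (suc k) 0≤x 0≤w = begin
  t * x * j * x * i + w * (t * x * j)
    ≤⟨ ≤-by (w * w * t * i) (0≤* (0≤* (0≤* 0≤w 0≤w) (0≤expTerm k 0≤x)) (0≤1/suc (suc k)))
         -- The identity needs `(k + 1) j = 1` and `(k + 2) i = 1`, which the ring solver cannot
         -- know; they enter as multiples of `1ℚ - m * j` and `(1ℚ + m) * i - 1ℚ`, which then
         -- vanish.
         (trans (cofactors t x w i j (fromℕ (suc k)) )
           (trans (cong₂ (λ a b → t * x * j * x * i + w * (t * x * j) + w * w * t * i + (w * x * t * i * (1ℚ - a) + w * (t * x * j) * (b - 1ℚ)))
                    (suc*1/suc k) (trans (cong (_* i) (sym (fromℕ-suc (suc k)))) (suc*1/suc (suc k))))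
             (vanish (t * x * j * x * i + w * (t * x * j) + w * w * t * i) (w * x * t * i) (w * (t * x * j))))) ⟩
  (t * x * j + w * t) * (x + w) * i
    ≤⟨ *-monoʳ i (0≤1/suc (suc k)) (*-monoʳ (x + w) (0≤+ 0≤x 0≤w) (expTerm-+ k 0≤x 0≤w)) ⟩
  expTerm (x + w) (suc k) * (x + w) * i ∎
  where
  open ≤-Reasoning
  t = expTerm x k
  i = 1/suc (suc k)
  j = 1/suc k
  cofactors : ∀ t x w i j m → (t * x * j + w * t) * (x + w) * i ≡
    t * x * j * x * i + w * (t * x * j) + w * w * t * i + (w * x * t * i * (1ℚ - m * j) + w * (t * x * j) * ((1ℚ + m) * i - 1ℚ))
  cofactors = solve-∀ ℚ-ring
  vanish : ∀ a b c → a + (b * (1ℚ - 1ℚ) + c * (1ℚ - 1ℚ)) ≡ a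
  vanish = solve-∀ ℚ-ring

expPartial-+ : ∀ {x w} m → 0ℚ ≤ x → 0ℚ ≤ w → expPartial x (suc m) + w * expPartial x m ≤ expPartial (x + w) (suc m)
expPartial-+ {x} {w} zero 0≤x 0≤w = ≤-reflexive (ring w)
  where
  ring : ∀ w → 0ℚ + 1ℚ + w * 0ℚ ≡ 0ℚ + 1ℚ
  ring = solve-∀ ℚ-ring
expPartial-+ {x} {w} (suc m) 0≤x 0≤w = begin
  E + t + t′ + w * (E + t)           ≡⟨ ring E t t′ w ⟩
  E + t + w * E + (t′ + w * t)       ≤⟨ +-mono-≤ (expPartial-+ m 0≤x 0≤w) (expTerm-+ m 0≤x 0≤w) ⟩
  expPartial (x + w) (suc (suc m))   ∎
  where
  open ≤-Reasoning
  E = expPartial x m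
  t = expTerm x m
  t′ = expTerm x (suc m)
  ring : ∀ E t t′ w → E + t + t′ + w * (E + t) ≡ E + t + w * E + (t′ + w * t)
  ring = solve-∀ ℚ-ring

-- A truncated form of `(1 + w) eˣ ≤ eˣ⁺ʷ`. Each factor `1ℚ + w` costs one more term of the series,
-- which is affordable because `y ≤ln n` bounds all partial sums.
expPartial-* : ∀ {x w} m → 0ℚ ≤ x → 0ℚ ≤ w → (1ℚ + w) * expPartial x m ≤ expPartial (x + w) (suc m)
expPartial-* {x} {w} m 0≤x 0≤w = ≤-trans
  (≤-by (expTerm x m) (0≤expTerm m 0≤x) (ring (expPartial x m) (expTerm x m) w))
  (expPartial-+ m 0≤x 0≤w)
  where
  ring : ∀ E t w → E + t + w * E ≡ (1ℚ + w) * E + t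
  ring = solve-∀ ℚ-ring

[1+w]^m≤expPartial : ∀ {x w} m → 0ℚ ≤ x → 0ℚ ≤ w → (1ℚ + w) ^ m ≤ expPartial (x + fromℕ m * w) (suc m)
[1+w]^m≤expPartial         zero    0≤x 0≤w = ≤-refl
[1+w]^m≤expPartial {x} {w} (suc m) 0≤x 0≤w = begin
  (1ℚ + w) * (1ℚ + w) ^ m                                ≤⟨ *-monoˡ (1ℚ + w) (0≤+ 0≤1 0≤w) ([1+w]^m≤expPartial m 0≤x 0≤w) ⟩
  (1ℚ + w) * expPartial (x + fromℕ m * w) (suc m)        ≤⟨ expPartial-* (suc m) (0≤+ 0≤x (0≤* (0≤fromℕ m) 0≤w)) 0≤w ⟩
  expPartial (x + fromℕ m * w + w) (suc (suc m))         ≡⟨ cong (λ z → expPartial z (suc (suc m))) (ring x (fromℕ m) w) ⟩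
  expPartial (x + (1ℚ + fromℕ m) * w) (suc (suc m))      ≡⟨ cong (λ z → expPartial (x + z * w) (suc (suc m))) (sym (fromℕ-suc m)) ⟩
  expPartial (x + fromℕ (suc m) * w) (suc (suc m))       ∎
  where
  open ≤-Reasoning
  ring : ∀ x m w → x + m * w + w ≡ x + (1ℚ + m) * w
  ring = solve-∀ ℚ-ring

[1+w]^m≤n : ∀ {y w n} m → 0ℚ ≤ w → fromℕ m * w ≤ y → y ≤ln n → (1ℚ + w) ^ m ≤ fromℕ n
[1+w]^m≤n {y} {w} {n} m 0≤w mw≤y (_ , exp≤n) = begin
  (1ℚ + w) ^ m                                           ≤⟨ [1+w]^m≤expPartial m (p≤q⇒0≤q-p mw≤y) 0≤w ⟩
  expPartial (y - fromℕ m * w + fromℕ m * w) (suc m)     ≡⟨ cong (λ z → expPartial z (suc m)) (ring y (fromℕ m * w)) ⟩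
  expPartial y (suc m)                                   ≤⟨ exp≤n (suc m) ⟩
  fromℕ n                                                ∎
  where
  open ≤-Reasoning
  ring : ∀ y z → y - z + z ≡ y
  ring = solve-∀ ℚ-ring

-- `P g` is promised only against a witness `m`, so `g` exists even when the search fails and then
-- defaults to 0. The value is chosen before `m` is given.
greatest : {P : ℕ → Set} → (∀ m → Dec (P m)) → ∀ b → Σ ℕ λ g → ∀ m → m ℕ.≤ b → P m → m ℕ.≤ g × P g
greatest {P} P? zero = 0 , λ m m≤0 pm → m≤0 , subst P (ℕₚ.n≤0⇒n≡0 m≤0) pm
greatest {P} P? (suc b) with P? (suc b) | greatest P? b
... | yes p | _     = suc b , λ m m≤1+b _ → m≤1+b , p
... | no ¬p | g , f = g , λ m m≤1+b pm → go m pm (ℕₚ.m≤n⇒m<n∨m≡n m≤1+b)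
  where
  go : ∀ m → P m → m ℕ.< suc b ⊎ m ≡ suc b → m ℕ.≤ g × P g
  go m pm (inj₁ (s≤s m≤b)) = f m m≤b pm
  go m pm (inj₂ refl)      = contradiction pm ¬p

-- The largest index reached when the index is raised by one, at most once per step, as soon as the next threshold is met.
module Diagonal (threshold : ℕ → ℕ) where

  advance : ∀ m n → Dec (threshold (suc m) ℕ.≤ n) → ℕ
  advance m n (yes _) = suc m
  advance m n (no _)  = m

  index : ℕ → ℕ
  index zero    = 0
  index (suc n) = advance (index n) (suc n) (threshold (suc (index n)) ℕ.≤? suc n)

  -- A positive index was reached by an advance that checked its threshold, and `n` has only grown
  -- since. The initial index 0 was never checked.
  threshold-index : ∀ n → 1 ℕ.≤ index n → threshold (index n) ℕ.≤ n
  threshold-index (suc n) 1≤ with threshold (suc (index n)) ℕ.≤? suc n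
  ... | yes le = le
  ... | no _   = ℕₚ.m≤n⇒m≤1+n (threshold-index n 1≤)

  index-suc : ∀ n → index n ℕ.≤ index (suc n)
  index-suc n with threshold (suc (index n)) ℕ.≤? suc n
  ... | yes _ = ℕₚ.n≤1+n (index n)
  ... | no _  = ℕₚ.≤-refl

  index-mono : ∀ {m n} → m ℕ.≤′ n → index m ℕ.≤ index n
  index-mono ℕ.≤′-refl           = ℕₚ.≤-refl
  index-mono (ℕ.≤′-step {n} m≤n) = ℕₚ.≤-trans (index-mono m≤n) (index-suc n)

  index-met : ∀ n → threshold (suc (index n)) ℕ.≤ suc n → suc (index n) ℕ.≤ index (suc n)
  index-met n le with threshold (suc (index n)) ℕ.≤? suc n
  ... | yes _ = ℕₚ.≤-refl
  ... | no ¬le = contradiction le ¬le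

  index-unbounded : ∀ m → Σ ℕ λ N → ∀ n → N ℕ.≤ n → m ℕ.≤ index n
  index-unbounded zero = 0 , λ _ _ → z≤n
  index-unbounded (suc m) with index-unbounded m
  ... | N , m≤index = suc N′ , λ n 1+N′≤n → ℕₚ.≤-trans reached (index-mono (ℕₚ.≤⇒≤′ 1+N′≤n))
    where
    N′ = N ℕ.⊔ threshold (suc m)
    reached : suc m ℕ.≤ index (suc N′)
    -- At `N′` the index is either already past `m`, or equal to `m`; in the latter case the awaited
    -- threshold is `threshold (suc m)`, which `N′` has reached, so the next step advances.
    reached with ℕₚ.m≤n⇒m<n∨m≡n (m≤index N′ (ℕₚ.m≤m⊔n N _))
    ... | inj₁ m<index = ℕₚ.≤-trans m<index (index-suc N′)
    ... | inj₂ m≡index = subst (λ i → suc i ℕ.≤ index (suc N′)) (sym m≡index)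
      (index-met N′ (subst (λ i → threshold (suc i) ℕ.≤ suc N′) m≡index (ℕₚ.m≤n⇒m≤1+n (ℕₚ.m≤n⊔m N (threshold (suc m))))))

-- The denominator of `δ` itself serves, since a positive numerator is at least 1.
1/suc≤ : ∀ δ → 0ℚ < δ → Σ ℕ λ d → 1/suc d ≤ δ
1/suc≤ δ@(mkℚ (ℤ.+ suc a) d _) 0<δ = d , toℚᵘ-cancel-≤ (begin
  toℚᵘ (1/suc d)        ≃⟨ toℚᵘ-fromℚᵘ (ℚᵘ.mkℚᵘ (ℤ.+ 1) d) ⟩
  ℚᵘ.mkℚᵘ (ℤ.+ 1) d     ≤⟨ ℚᵘ.*≤* (ℤₚ.*-monoʳ-≤-nonNeg (ℤ.+ suc d) (ℤ.+≤+ (s≤s (z≤n {a})))) ⟩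
  toℚᵘ δ                ∎)
  where open ℚᵘₚ.≤-Reasoning
1/suc≤ δ@(mkℚ (ℤ.+ zero) d _) 0<δ with positive 0<δ
... | ()
1/suc≤ δ@(mkℚ (ℤ.-[1+ a ]) d _) 0<δ with positive 0<δ
... | ()

2/suc≤1/suc : ∀ d m → 2 ℕ.* suc d ℕ.≤ suc m → 2ℚ * 1/suc m ≤ 1/suc d
2/suc≤1/suc d m le = begin
  2ℚ * x                                  ≡⟨ *-identityʳ (2ℚ * x) ⟨
  2ℚ * x * 1ℚ                             ≡⟨ cong (2ℚ * x *_) (suc*1/suc d) ⟨
  2ℚ * x * (fromℕ (suc d) * y)            ≡⟨ ring x (fromℕ (suc d)) y ⟩
  2ℚ * fromℕ (suc d) * (x * y)            ≡⟨ cong (_* (x * y)) (fromℕ-* 2 (suc d)) ⟨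
  fromℕ (2 ℕ.* suc d) * (x * y)           ≤⟨ *-monoʳ (x * y) (0≤* (0≤1/suc m) (0≤1/suc d)) (fromℕ-mono-≤ le) ⟩
  fromℕ (suc m) * (x * y)                 ≡⟨ *-assoc (fromℕ (suc m)) x y ⟨
  fromℕ (suc m) * x * y                   ≡⟨ cong (_* y) (suc*1/suc m) ⟩
  1ℚ * y                                  ≡⟨ *-identityˡ y ⟩
  y                                       ∎
  where
  open ≤-Reasoning
  x = 1/suc m
  y = 1/suc d
  ring : ∀ x d y → (1ℚ + 1ℚ) * x * (d * y) ≡ (1ℚ + 1ℚ) * d * (x * y)
  ring = solve-∀ ℚ-ring

2/suc-tendsToZero : ∀ (f : ℕ → ℕ) → (∀ m → Σ ℕ λ N → ∀ n → N ℕ.≤ n → m ℕ.≤ f n) → TendsToZero (λ n → 2ℚ * 1/suc (suc (f n)))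
2/suc-tendsToZero f unbounded δ 0<δ with 1/suc≤ δ 0<δ
... | d , 1/suc-d≤δ with unbounded (2 ℕ.* suc d)
... | N , large = N , λ n N≤n → subst (_≤ δ) (sym (0≤p⇒∣p∣≡p (0≤* 0≤2 (0≤1/suc (suc (f n))))))
  (≤-trans (2/suc≤1/suc d (suc (f n)) (ℕₚ.m≤n⇒m≤1+n (ℕₚ.m≤n⇒m≤1+n (large n N≤n)))) 1/suc-d≤δ)

-- Asymptotics

^-comm-exp : ∀ x m n → (x ^ m) ^ n ≡ (x ^ n) ^ m
^-comm-exp x m n = trans (^-assocʳ x m n) (trans (cong (x ^_) (ℕₚ.*-comm m n)) (sym (^-assocʳ x n m)))

-- Z and N stand for t and n; z, ν, η and f for the inverses of t, n, t + 1 and t + 2. The loss is ε = 2 f, and w solves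
-- (1 - ε) ½ N w = 1.
module Parameters {Z z N ν η f : ℚ}
  (Zz≡1 : Z * z ≡ 1ℚ) (Nν≡1 : N * ν ≡ 1ℚ) (η≡ : (1ℚ + Z) * η ≡ 1ℚ) (f≡ : (1ℚ + (1ℚ + Z)) * f ≡ 1ℚ)
  (1≤Z : 1ℚ ≤ Z) (0≤z : 0ℚ ≤ z) (0≤ν : 0ℚ ≤ ν) (0≤η : 0ℚ ≤ η)
  (large : 2ℚ * ((1ℚ + (1ℚ + Z)) * (1ℚ + (1ℚ + Z)) * (1ℚ + Z)) ≤ N) (4≤N : 2ℚ * 2ℚ ≤ N) where

  α w : ℚ
  α = 2ℚ * (1ℚ + η) * ν
  w = 2ℚ * (1ℚ + (1ℚ + Z)) * z * ν

  0≤Z : 0ℚ ≤ Z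
  0≤Z = ≤-trans 0≤1 1≤Z

  Nα≡ : N * α ≡ 2ℚ * (1ℚ + η)
  Nα≡ = trans (ring N η ν) (trans (cong (2ℚ * (1ℚ + η) *_) Nν≡1) (*-identityʳ _))
    where
    ring : ∀ N η ν → N * ((1ℚ + 1ℚ) * (1ℚ + η) * ν) ≡ (1ℚ + 1ℚ) * (1ℚ + η) * (N * ν)
    ring = solve-∀ ℚ-ring

  0≤α : 0ℚ ≤ α
  0≤α = 0≤* (0≤* 0≤2 (0≤+ 0≤1 0≤η)) 0≤ν

  0≤w : 0ℚ ≤ w
  0≤w = 0≤* (0≤* (0≤* 0≤2 (0≤+ 0≤1 (0≤+ 0≤1 0≤Z))) 0≤z) 0≤ν

  η≤½ : η ≤ ½
  η≤½ = ≤-by (½ * (η * (Z - 1ℚ))) (0≤* 0≤½ (0≤* 0≤η (p≤q⇒0≤q-p 1≤Z)))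
    (trans (trans (sym (*-identityʳ ½)) (cong (½ *_) (sym η≡))) (ring Z η))
    where
    ring : ∀ Z η → ½ * ((1ℚ + Z) * η) ≡ η + ½ * (η * (Z - 1ℚ))
    ring = solve-∀ ℚ-ring

  α≤1 : α ≤ 1ℚ
  α≤1 = begin
    2ℚ * (1ℚ + η) * ν   ≤⟨ *-monoʳ ν 0≤ν (*-monoˡ 2ℚ 0≤2 (+-monoʳ-≤ 1ℚ (≤-trans η≤½ (≤-by ½ 0≤½ refl)))) ⟩
    2ℚ * 2ℚ * ν         ≤⟨ *-monoʳ ν 0≤ν 4≤N ⟩
    N * ν               ≡⟨ Nν≡1 ⟩
    1ℚ                  ∎
    where open ≤-Reasoning

  ν≤w : ν ≤ w
  ν≤w = ≤-by (ν + 2ℚ * (2ℚ * z * ν)) (0≤+ 0≤ν (0≤* 0≤2 (0≤* (0≤* 0≤2 0≤z) 0≤ν)))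
    (trans (ring₁ Z z ν) (trans (cong (λ a → 2ℚ * a * ν + 2ℚ * (2ℚ * z * ν)) Zz≡1) (ring₂ ν (2ℚ * (2ℚ * z * ν)))))
    where
    ring₁ : ∀ Z z ν → (1ℚ + 1ℚ) * (1ℚ + (1ℚ + Z)) * z * ν ≡ (1ℚ + 1ℚ) * (Z * z) * ν + (1ℚ + 1ℚ) * ((1ℚ + 1ℚ) * z * ν)
    ring₁ = solve-∀ ℚ-ring
    ring₂ : ∀ ν x → (1ℚ + 1ℚ) * 1ℚ * ν + x ≡ ν + (ν + x)
    ring₂ = solve-∀ ℚ-ring

  horizon*w≤ : ∀ {T y} → T ≤ (1ℚ - 2ℚ * f) * ½ * N * y → T * w ≤ y
  horizon*w≤ {T} {y} T≤ = begin
    T * w                                    ≤⟨ *-monoʳ w 0≤w T≤ ⟩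
    (1ℚ - 2ℚ * f) * ½ * N * y * w            ≡⟨ ring₁ Z z N ν f y ⟩
    (1ℚ + (1ℚ + Z) - 2ℚ * ((1ℚ + (1ℚ + Z)) * f)) * z * (N * ν) * y
      ≡⟨ cong₂ (λ a b → (1ℚ + (1ℚ + Z) - 2ℚ * a) * z * b * y) f≡ Nν≡1 ⟩
    (1ℚ + (1ℚ + Z) - 2ℚ * 1ℚ) * z * 1ℚ * y   ≡⟨ ring₂ Z z y ⟩
    Z * z * y                                ≡⟨ cong (_* y) Zz≡1 ⟩
    1ℚ * y                                   ≡⟨ *-identityˡ y ⟩
    y                                        ∎
    where
    open ≤-Reasoning
    ring₁ : ∀ Z z N ν f y → (1ℚ - (1ℚ + 1ℚ) * f) * ½ * N * y * ((1ℚ + 1ℚ) * (1ℚ + (1ℚ + Z)) * z * ν) ≡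
      (1ℚ + (1ℚ + Z) - (1ℚ + 1ℚ) * ((1ℚ + (1ℚ + Z)) * f)) * z * (N * ν) * y
    ring₁ = solve-∀ ℚ-ring
    ring₂ : ∀ Z z y → (1ℚ + (1ℚ + Z) - (1ℚ + 1ℚ) * 1ℚ) * z * 1ℚ * y ≡ Z * z * y
    ring₂ = solve-∀ ℚ-ring

  -- The first-order gain `(t + 1) w - (t + 2) α` equals `2 (t + 2) / (t (t + 1) n)`, positive
  -- because `(t + 1)²` exceeds `t (t + 2)` by one. The second-order loss is `4 (t + 2)³ / (t n²)`,
  -- and it is covered exactly when `n ≥ 2 (t + 2)² (t + 1)`, which is `large`. The witness `D` is
  -- the difference.
  1≤linear : 1ℚ ≤ (1ℚ + (1ℚ + (1ℚ + Z)) * (- α)) * (1ℚ + (1ℚ + Z) * w)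
  1≤linear = ≤-by D 0≤D (trans (cofactors Z z N ν η)
    (trans (cong (λ a → 1ℚ + D + 2ℚ * S′ * ν * a)
      (cong₂ _+_ (cong₂ _+_ (kill (1ℚ + η) Zz≡1) (kill (- (z * η)) Nν≡1)) (kill (2ℚ * S′ * S * z * ν - z) η≡)))
      (vanish (1ℚ + D) (2ℚ * S′ * ν))))
    where
    S = 1ℚ + Z
    S′ = 1ℚ + (1ℚ + Z)
    D = 2ℚ * S′ * ν * (z * η * ν * (N - 2ℚ * (S′ * S′ * S)))
    0≤S′ = 0≤+ 0≤1 (0≤+ 0≤1 0≤Z)
    0≤D : 0ℚ ≤ D
    0≤D = 0≤* (0≤* (0≤* 0≤2 0≤S′) 0≤ν) (0≤* (0≤* (0≤* 0≤z 0≤η) 0≤ν) (p≤q⇒0≤q-p large))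
    kill : ∀ c {p} → p ≡ 1ℚ → c * (p - 1ℚ) ≡ 0ℚ
    kill c refl = *-zeroʳ c
    vanish : ∀ x y → x + y * 0ℚ ≡ x
    vanish = solve-∀ ℚ-ring
    -- The identity holds only modulo Z z = 1, N ν = 1 and (1 + Z) η = 1, hence the explicit cofactors.
    cofactors : ∀ Z z N ν η →
      (1ℚ + (1ℚ + (1ℚ + Z)) * (- ((1ℚ + 1ℚ) * (1ℚ + η) * ν))) * (1ℚ + (1ℚ + Z) * ((1ℚ + 1ℚ) * (1ℚ + (1ℚ + Z)) * z * ν)) ≡
      1ℚ + (1ℚ + 1ℚ) * (1ℚ + (1ℚ + Z)) * ν * (z * η * ν * (N - (1ℚ + 1ℚ) * ((1ℚ + (1ℚ + Z)) * (1ℚ + (1ℚ + Z)) * (1ℚ + Z)))) +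
      (1ℚ + 1ℚ) * (1ℚ + (1ℚ + Z)) * ν *
        ((1ℚ + η) * (Z * z - 1ℚ) + - (z * η) * (N * ν - 1ℚ) +
         ((1ℚ + 1ℚ) * (1ℚ + (1ℚ + Z)) * (1ℚ + Z) * z * ν - z) * ((1ℚ + Z) * η - 1ℚ))
    cofactors = solve-∀ ℚ-ring

-- As (1 - α)ᵀ n is only known to be at least n to the power 1 / (t + 2), n is cut into (p + 1)(t + 2) shares, and Bernoulli's
-- inequality on each of them makes (1 + u)ⁿ beat a constant times n to the power p + 1.
module Threshold (p t : ℕ) where

  -- `scale` is the constant in `A n ≤ scale * share * u` with `u = ½ η A`: rounding `share` costs a
  -- factor 2, the ½ another, and `η = 1 / (t + 1)` the rest. The summands of `threshold` secure in
  -- turn `large` for `1≤linear`, a nonzero `share`, the strict bound `2 * scale ^ degree < n`, and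
  -- `α ≤ 1`.
  degree scale threshold : ℕ
  degree    = suc (suc t) ℕ.* suc p
  scale     = 2 ℕ.* (2 ℕ.* degree ℕ.* suc t)
  threshold = 2 ℕ.* (suc (suc t) ℕ.* suc (suc t) ℕ.* suc t) ℕ.+ (degree ℕ.+ (2 ℕ.* scale ℕ.^ degree ℕ.+ 4))

  module _ {n} (threshold≤n : threshold ℕ.≤ n) where

    large-ℕ : 2 ℕ.* (suc (suc t) ℕ.* suc (suc t) ℕ.* suc t) ℕ.≤ n
    large-ℕ = ℕₚ.≤-trans (ℕₚ.m≤m+n _ _) threshold≤n

    rest≤n : degree ℕ.+ (2 ℕ.* scale ℕ.^ degree ℕ.+ 4) ℕ.≤ n
    rest≤n = ℕₚ.≤-trans (ℕₚ.m≤n+m _ (2 ℕ.* (suc (suc t) ℕ.* suc (suc t) ℕ.* suc t))) threshold≤n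

    degree≤n : degree ℕ.≤ n
    degree≤n = ℕₚ.≤-trans (ℕₚ.m≤m+n _ _) rest≤n

    last≤n : 2 ℕ.* scale ℕ.^ degree ℕ.+ 4 ℕ.≤ n
    last≤n = ℕₚ.≤-trans (ℕₚ.m≤n+m _ degree) rest≤n

    4≤n : 4 ℕ.≤ n
    4≤n = ℕₚ.≤-trans (ℕₚ.m≤n+m _ (2 ℕ.* scale ℕ.^ degree)) last≤n

    scale<n : 2 ℕ.* scale ℕ.^ degree ℕ.< n
    scale<n = ℕₚ.<-≤-trans (ℕₚ.m<m+n _ (s≤s z≤n)) last≤n

    share : ℕ
    share = n ℕ./ degree

    share*degree≤n : share ℕ.* degree ℕ.≤ n
    share*degree≤n = ℕ/.m/n*n≤m n degree

    -- The remainder is below `degree`, hence below `degree * share`, as `degree ≤ n` makes `share`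
    -- at least 1.
    n≤2*share*degree : n ℕ.≤ 2 ℕ.* degree ℕ.* share
    n≤2*share*degree = begin
      n                                          ≡⟨ ℕ/.m≡m%n+[m/n]*n n degree ⟩
      n ℕ.% degree ℕ.+ share ℕ.* degree          ≤⟨ ℕₚ.+-monoˡ-≤ _ (ℕₚ.<⇒≤ (ℕ/.m%n<n n degree)) ⟩
      degree ℕ.+ share ℕ.* degree                ≤⟨ ℕₚ.+-monoˡ-≤ _ (ℕₚ.m≤m*n degree share {{ℕ.>-nonZero (ℕ/.m≥n⇒m/n>0 degree≤n)}}) ⟩
      degree ℕ.* share ℕ.+ share ℕ.* degree      ≡⟨ cong (degree ℕ.* share ℕ.+_) (ℕₚ.*-comm share degree) ⟩
      degree ℕ.* share ℕ.+ degree ℕ.* share      ≡⟨ cong (degree ℕ.* share ℕ.+_) (ℕₚ.+-identityʳ _) ⟨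
      2 ℕ.* (degree ℕ.* share)                   ≡⟨ ℕₚ.*-assoc 2 degree share ⟨
      2 ℕ.* degree ℕ.* share                     ∎
      where open ℕₚ.≤-Reasoning

    -- Aiming at `n ^ suc p` instead of `n ^ p` leaves one spare factor `n`, which outweighs the
    -- constant `2 * scale ^ degree`; cancelling `scale ^ degree` at the end leaves the claim.
    few-cops : ∀ {k η A} → 0ℚ ≤ η → 0ℚ ≤ A → fromℕ (suc t) * η ≡ 1ℚ → fromℕ n ≤ (A * fromℕ n) ^ suc (suc t) →
      k ℕ.≤ n ℕ.^ p → 2ℚ * fromℕ k < (1ℚ + ½ * (η * A)) ^ n
    few-cops {k} {η} {A} 0≤η 0≤A η≡ N≤ k≤n^p = *-cancelˡ-<-nonNeg (M ^ degree) {{nonNegative (0≤^ degree 0≤M)}} (begin-strict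
      M ^ degree * (2ℚ * fromℕ k)                     ≡⟨ cast ⟩
      fromℕ (2 ℕ.* scale ℕ.^ degree ℕ.* k)            <⟨ fromℕ-mono-< 2M^rk<n^[1+p] ⟩
      fromℕ (n ℕ.^ suc p)                             ≡⟨ fromℕ-^ n (suc p) ⟩
      N ^ suc p                                       ≤⟨ ^-monoˡ-≤ (suc p) (0≤fromℕ n) N≤ ⟩
      ((A * N) ^ suc (suc t)) ^ suc p                 ≡⟨ ^-assocʳ (A * N) (suc (suc t)) (suc p) ⟩
      (A * N) ^ degree                                ≤⟨ ^-monoˡ-≤ degree (0≤* 0≤A (0≤fromℕ n)) AN≤ ⟩
      (M * (1ℚ + fromℕ share * u)) ^ degree           ≡⟨ ^-distrib-* M (1ℚ + fromℕ share * u) degree ⟩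
      M ^ degree * (1ℚ + fromℕ share * u) ^ degree    ≤⟨ *-monoˡ (M ^ degree) (0≤^ degree 0≤M) power≤ ⟩
      M ^ degree * (1ℚ + u) ^ n                       ∎)
      where
      open ≤-Reasoning
      N = fromℕ n
      M = fromℕ scale
      u = ½ * (η * A)
      0≤M : 0ℚ ≤ M
      0≤M = 0≤fromℕ scale
      0≤u : 0ℚ ≤ u
      0≤u = 0≤* 0≤½ (0≤* 0≤η 0≤A)
      cast : M ^ degree * (2ℚ * fromℕ k) ≡ fromℕ (2 ℕ.* scale ℕ.^ degree ℕ.* k)
      cast = sym (trans (fromℕ-* (2 ℕ.* scale ℕ.^ degree) k) (trans (cong (_* fromℕ k) (trans (fromℕ-* 2 (scale ℕ.^ degree)) (cong (2ℚ *_) (fromℕ-^ scale degree)))) (ring (M ^ degree) (fromℕ k))))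
        where
        ring : ∀ m k → (1ℚ + 1ℚ) * m * k ≡ m * ((1ℚ + 1ℚ) * k)
        ring = solve-∀ ℚ-ring
      2M^rk<n^[1+p] : 2 ℕ.* scale ℕ.^ degree ℕ.* k ℕ.< n ℕ.^ suc p
      2M^rk<n^[1+p] = ℕₚ.≤-<-trans (ℕₚ.*-monoʳ-≤ (2 ℕ.* scale ℕ.^ degree) k≤n^p)
        (ℕₚ.*-monoˡ-< (n ℕ.^ p) {{ℕₚ.m^n≢0 n p {{ℕ.>-nonZero (ℕₚ.≤-trans (s≤s z≤n) 4≤n)}}}} scale<n)
      AN≤ : A * N ≤ M * (1ℚ + fromℕ share * u)
      AN≤ = begin
        A * N                                                          ≤⟨ *-monoˡ A 0≤A (fromℕ-mono-≤ n≤2*share*degree) ⟩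
        A * fromℕ (2 ℕ.* degree ℕ.* share)                             ≡⟨ cong (A *_) (trans (fromℕ-* (2 ℕ.* degree) share) (cong (_* fromℕ share) (fromℕ-* 2 degree))) ⟩
        A * (2ℚ * fromℕ degree * fromℕ share)                          ≡⟨ *-identityʳ _ ⟨
        A * (2ℚ * fromℕ degree * fromℕ share) * 1ℚ                     ≡⟨ cong (A * (2ℚ * fromℕ degree * fromℕ share) *_) η≡ ⟨
        A * (2ℚ * fromℕ degree * fromℕ share) * (fromℕ (suc t) * η)    ≡⟨ ring A (fromℕ degree) (fromℕ share) (fromℕ (suc t)) η ⟩
        2ℚ * (2ℚ * fromℕ degree * fromℕ (suc t)) * (fromℕ share * u)   ≡⟨ cong (_* (fromℕ share * u)) (trans (fromℕ-* 2 (2 ℕ.* degree ℕ.* suc t)) (cong (2ℚ *_) (trans (fromℕ-* (2 ℕ.* degree) (suc t)) (cong (_* fromℕ (suc t)) (fromℕ-* 2 degree))))) ⟨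
        M * (fromℕ share * u)                                          ≤⟨ *-monoˡ M 0≤M (≤-by 1ℚ 0≤1 (+-comm 1ℚ (fromℕ share * u))) ⟩
        M * (1ℚ + fromℕ share * u)                                     ∎
        where
        ring : ∀ A d h s η → A * ((1ℚ + 1ℚ) * d * h) * (s * η) ≡ (1ℚ + 1ℚ) * ((1ℚ + 1ℚ) * d * s) * (h * (½ * (η * A)))
        ring = solve-∀ ℚ-ring
      power≤ : (1ℚ + fromℕ share * u) ^ degree ≤ (1ℚ + u) ^ n
      power≤ = begin
        (1ℚ + fromℕ share * u) ^ degree   ≤⟨ ^-monoˡ-≤ degree (0≤+ 0≤1 (0≤* (0≤fromℕ share) 0≤u)) (bernoulli₁ share (0≤+ 0≤1 0≤u)) ⟩
        ((1ℚ + u) ^ share) ^ degree       ≡⟨ ^-assocʳ (1ℚ + u) share degree ⟩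
        (1ℚ + u) ^ (share ℕ.* degree)     ≤⟨ ^-monoʳ-≤ (≤-by u 0≤u refl) share*degree≤n ⟩
        (1ℚ + u) ^ n                      ∎

-- Bernoulli's inequality gives (1 - α)ˢ⁺¹ (1 + w)ˢ ≥ 1; its T-th power and (1 + w)ᵀ ≤ N give ((1 - α)ᵀ)ˢ⁺¹ Nˢ ≥ 1.
contraction≥ : ∀ {α w N} s T → 0ℚ ≤ α → α ≤ 1ℚ → 0ℚ ≤ w → 0ℚ ≤ N →
  1ℚ ≤ (1ℚ + fromℕ (suc s) * (- α)) * (1ℚ + fromℕ s * w) → (1ℚ + w) ^ T ≤ N →
  N ≤ ((1ℚ - α) ^ T * N) ^ suc s
contraction≥ {α} {w} {N} s T 0≤α α≤1 0≤w 0≤N 1≤linear W≤N = begin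
  N                                                ≡⟨ *-identityʳ N ⟨
  N * 1ℚ                                           ≤⟨ *-monoˡ N 0≤N (1≤^ T 1≤product) ⟩
  N * ((1ℚ - α) ^ suc s * (1ℚ + w) ^ s) ^ T        ≡⟨ cong (N *_) (^-distrib-* ((1ℚ - α) ^ suc s) ((1ℚ + w) ^ s) T) ⟩
  N * (((1ℚ - α) ^ suc s) ^ T * ((1ℚ + w) ^ s) ^ T) ≡⟨ cong₂ (λ a b → N * (a * b)) (^-comm-exp (1ℚ - α) (suc s) T) (^-comm-exp (1ℚ + w) s T) ⟩
  N * (A ^ suc s * ((1ℚ + w) ^ T) ^ s)             ≤⟨ *-monoˡ N 0≤N (*-monoˡ (A ^ suc s) (0≤^ (suc s) 0≤A) (^-monoˡ-≤ s (0≤^ T 0≤1+w) W≤N)) ⟩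
  N * (A ^ suc s * N ^ s)                          ≡⟨ swap N (A ^ suc s) (N ^ s) ⟩
  A ^ suc s * (N * N ^ s)                          ≡⟨ ^-distrib-* A N (suc s) ⟨
  (A * N) ^ suc s                                  ∎
  where
  open ≤-Reasoning
  A = (1ℚ - α) ^ T
  0≤1-α : 0ℚ ≤ 1ℚ - α
  0≤1-α = p≤q⇒0≤q-p α≤1
  0≤A : 0ℚ ≤ A
  0≤A = 0≤^ T 0≤1-α
  0≤1+w : 0ℚ ≤ 1ℚ + w
  0≤1+w = 0≤+ 0≤1 0≤w
  swap : ∀ a b c → a * (b * c) ≡ b * (a * c)
  swap = solve-∀ ℚ-ring
  1≤product : 1ℚ ≤ (1ℚ - α) ^ suc s * (1ℚ + w) ^ s
  1≤product = begin
    1ℚ                                                          ≤⟨ 1≤linear ⟩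
    (1ℚ + fromℕ (suc s) * (- α)) * (1ℚ + fromℕ s * w)           ≤⟨ *-monoʳ (1ℚ + fromℕ s * w) (0≤+ 0≤1 (0≤* (0≤fromℕ s) 0≤w)) (bernoulli₁ (suc s) 0≤1-α) ⟩
    (1ℚ - α) ^ suc s * (1ℚ + fromℕ s * w)                       ≤⟨ *-monoˡ ((1ℚ - α) ^ suc s) (0≤^ (suc s) 0≤1-α) (bernoulli₁ s 0≤1+w) ⟩
    (1ℚ - α) ^ suc s * (1ℚ + w) ^ s                             ∎

-- A ceiling for the bounded search that depends on `n` alone: `1 + T w ≤ (1 + w)ᵀ ≤ n`, and `w` is
-- at least `1 / n`.
horizon≤n² : ∀ {n ν w} T → fromℕ n * ν ≡ 1ℚ → ν ≤ w → 0ℚ ≤ w → (1ℚ + w) ^ T ≤ fromℕ n → T ℕ.≤ n ℕ.* n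
horizon≤n² {n} {ν} {w} T Nν≡1 ν≤w 0≤w W≤N = fromℕ-cancel-≤ (begin
  fromℕ T                         ≡⟨ *-identityˡ (fromℕ T) ⟨
  1ℚ * fromℕ T                    ≡⟨ cong (_* fromℕ T) Nν≡1 ⟨
  fromℕ n * ν * fromℕ T           ≡⟨ ring (fromℕ n) ν (fromℕ T) ⟩
  fromℕ n * (fromℕ T * ν)         ≤⟨ *-monoˡ (fromℕ n) (0≤fromℕ n) (*-monoˡ (fromℕ T) (0≤fromℕ T) ν≤w) ⟩
  fromℕ n * (fromℕ T * w)         ≤⟨ *-monoˡ (fromℕ n) (0≤fromℕ n) (≤-by 1ℚ 0≤1 (+-comm 1ℚ (fromℕ T * w))) ⟩
  fromℕ n * (1ℚ + fromℕ T * w)    ≤⟨ *-monoˡ (fromℕ n) (0≤fromℕ n) (≤-trans (bernoulli₁ T (0≤+ 0≤1 0≤w)) W≤N) ⟩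
  fromℕ n * fromℕ n               ≡⟨ fromℕ-* n n ⟨
  fromℕ (n ℕ.* n)                 ∎)
  where
  open ≤-Reasoning
  ring : ∀ n ν t → n * ν * t ≡ n * (t * ν)
  ring = solve-∀ ℚ-ring

-- Turns `k ^ q ≤ n ^ p`, the form of `k ≤ nᵈ` for `d = p / q`, into the integral bound `k ≤ n ^ p`:
-- the size of the polynomial affects only the threshold, not the loss as a function of the index.
m≤m^q : ∀ m {q} → 1 ℕ.≤ q → m ℕ.≤ m ℕ.^ q
m≤m^q zero          1≤q = z≤n
m≤m^q m@(suc _) {q} 1≤q = subst (ℕ._≤ m ℕ.^ q) (ℕₚ.*-identityʳ m) (ℕₚ.^-monoʳ-≤ m 1≤q)

-- The robber has to be fixed before the number T of rounds is known, so it plays for the largest horizon up to n² that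
-- passes the decidable test Small.
robber-survives : ∀ p t′ {n k} → let t = suc t′ in Threshold.threshold p t ℕ.≤ n → k ℕ.≤ n ℕ.^ p →
  (σ : CopStrategy n k) → LegalCop σ → Σ (RobberStrategy n k) λ ρ → LegalRobber ρ ×
  (∀ T y → y ≤ln n → fromℕ T ≤ (1ℚ - 2ℚ * 1/suc (suc t)) * ½ * fromℕ n * y → Survives σ ρ T)
robber-survives p t′ {zero} N≤n = contradiction (ℕₚ.≤-trans (s≤s z≤n) (Threshold.4≤n p (suc t′) N≤n)) λ ()
robber-survives p t′ {n@(suc n′)} {k} N≤n k≤n^p σ legal = Evasion.robber 0<n Nα≡ 0≤α α≤1 0≤η η≤½ T* , Evasion.robber-legal 0<n Nα≡ 0≤α α≤1 0≤η η≤½ T* , λ T y y≤ln T≤ →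
  let W≤N = [1+w]^m≤n {n = n} T 0≤w (horizon*w≤ T≤) y≤ln
      small = few-cops {n} N≤n {k} 0≤η (0≤^ T (p≤q⇒0≤q-p α≤1)) (suc*1/suc t)
                (contraction≥ (suc t) T 0≤α α≤1 0≤w (0≤fromℕ n) 1≤linear′ W≤N) k≤n^p
      T≤T* , small* = T*-max T (horizon≤n² {n} T (suc*1/suc n′) ν≤w 0≤w W≤N) small
  in Evasion.survives 0<n Nα≡ 0≤α α≤1 0≤η η≤½ σ legal T* small* T T≤T*
  where
  t = suc t′
  0<n : 0 ℕ.< n
  0<n = s≤s z≤n
  S≡ : fromℕ (suc t) ≡ 1ℚ + fromℕ t
  S≡ = fromℕ-suc t
  S′≡ : fromℕ (suc (suc t)) ≡ 1ℚ + (1ℚ + fromℕ t)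
  S′≡ = trans (fromℕ-suc (suc t)) (cong (1ℚ +_) S≡)
  η : ℚ
  η = 1/suc t
  0≤η : 0ℚ ≤ η
  0≤η = 0≤1/suc t
  open Threshold p t using (few-cops; large-ℕ; 4≤n)
  large : 2ℚ * ((1ℚ + (1ℚ + fromℕ t)) * (1ℚ + (1ℚ + fromℕ t)) * (1ℚ + fromℕ t)) ≤ fromℕ n
  large = subst (_≤ fromℕ n) (trans (fromℕ-* 2 (s′ ℕ.* s′ ℕ.* suc t)) (cong (2ℚ *_)
    (trans (fromℕ-* (s′ ℕ.* s′) (suc t)) (cong₂ _*_ (trans (fromℕ-* s′ s′) (cong₂ _*_ S′≡ S′≡)) S≡))))
    (fromℕ-mono-≤ (large-ℕ N≤n))
    where s′ = suc (suc t)
  open Parameters {fromℕ t} {1/suc t′} {fromℕ n} {1/suc n′} {η} {1/suc (suc t)}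
    (suc*1/suc t′) (suc*1/suc n′) (trans (cong (_* η) (sym S≡)) (suc*1/suc t))
    (trans (cong (_* 1/suc (suc t)) (sym S′≡)) (suc*1/suc (suc t)))
    (fromℕ-mono-≤ {1} {t} (s≤s z≤n)) (0≤1/suc t′) (0≤1/suc n′) 0≤η large (fromℕ-mono-≤ (4≤n N≤n))
  1≤linear′ : 1ℚ ≤ (1ℚ + fromℕ (suc (suc t)) * (- α)) * (1ℚ + fromℕ (suc t) * w)
  1≤linear′ = subst₂ (λ a b → 1ℚ ≤ (1ℚ + a * (- α)) * (1ℚ + b * w)) (sym S′≡) (sym S≡) 1≤linear
  Small : ℕ → Set
  Small T = 2ℚ * fromℕ k < (1ℚ + ½ * (η * (1ℚ - α) ^ T)) ^ n
  horizon = greatest {Small} (λ T → 2ℚ * fromℕ k <? (1ℚ + ½ * (η * (1ℚ - α) ^ T)) ^ n) (n ℕ.* n)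
  T* = proj₁ horizon
  T*-max = proj₂ horizon

theorem3p3 : (p q : ℕ) → 1 ℕ.≤ p → 1 ℕ.≤ q →
    Σ (ℕ → ℚ) λ ε → TendsToZero ε ×
    Σ ℕ λ N → ∀ n → N ℕ.≤ n →
    ∀ k → k ℕ.^ q ℕ.≤ n ℕ.^ p →
    (σ : CopStrategy n k) → LegalCop σ →
    Σ (RobberStrategy n k) λ ρ → LegalRobber ρ ×
    (∀ (T : ℕ) (y : ℚ) → y ≤ln n →
    fromℕ T ≤ (1ℚ - ε n) * ½ * fromℕ n * y →
    Survives σ ρ T)
theorem3p3 p q _ 1≤q =
  (λ n → 2ℚ * 1/suc (suc (index n))) , 2/suc-tendsToZero index index-unbounded ,
  -- From this `N` on the index `t` is positive, so its threshold has been met and `1 / t`, which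
  -- occurs in `w`, makes sense.
  proj₁ (index-unbounded 1) , λ n N≤n k k^q≤n^p σ legal →
    evade n k (proj₂ (index-unbounded 1) n N≤n) (ℕₚ.≤-trans (m≤m^q k 1≤q) k^q≤n^p) σ legal
  where
  open Diagonal (Threshold.threshold p)
  evade : ∀ n k → 1 ℕ.≤ index n → k ℕ.≤ n ℕ.^ p → (σ : CopStrategy n k) → LegalCop σ →
    Σ (RobberStrategy n k) λ ρ → LegalRobber ρ ×
    (∀ T y → y ≤ln n → fromℕ T ≤ (1ℚ - 2ℚ * 1/suc (suc (index n))) * ½ * fromℕ n * y → Survives σ ρ T)
  evade n k 1≤i k≤n^p with index n | threshold-index n
  ... | zero   | _     = contradiction 1≤i λ ()
  ... | suc t′ | valid = robber-survives p t′ (valid 1≤i) k≤n^p
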